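{- Let $m\ge1$, let $x,y,t,q$ be variables and $X=(x_0,x_1,\dots)$, $Y=(y_0,y_1,\dots)$ commutative alphabets. Define $$\Phi_m(t;x,y,X,Y,q)=\sum_{I} t^{\mathrm{size}(I)}\,x^{\mathrm{mcontacts}(I)}\,y^{\mathrm{mrises}(I)}\,\mathrm{mContactMon}(I,X)\,\mathrm{mRiseMon}(I,Y)\,q^{\mathrm{dist}(I)},$$ summed over all intervals $I$ of the $m$-Tamari lattices $\mathrm{Tam}_n^m$ (all $n$). Then $\Phi_m(t;x,y,X,Y,q)=\Phi_m(t;y,x,Y,X,q)$ (exchange $x\leftrightarrow y$ and $x_i\leftrightarrow y_i$).
   Context: An $m$-ballot path of size $n$ is a lattice path from $(0,0)$ to $(nm,n)$ with unit vertical steps $(0,1)$ and horizontal steps $(1,0)$ staying weakly above the line $y=x/m$. A primitive path is one touching $y=x/m$ only at its endpoints. The $m$-Tamari lattice $\mathrm{Tam}_n^m$ is the order on $m$-ballot paths of size $n$ generated by rotations: take a horizontal step $d$ followed by a vertical step, and the (translated) primitive path $p$ starting right after $d$ (i.e. the subpath from the end of $d$ up to its first return to the line of slope $1/m$ through the end of $d$); the rotation exchanges $d$ and $p$ (so $\dots d\,p\dots\mapsto\dots p\,d\dots$), producing a larger path. An interval is $I=[B_1,B_2]$ with $B_1\le B_2$; $\mathrm{size}(I)=n$; $\mathrm{dist}(I)$ is the maximal length (number of cover relations) of a chain from $B_1$ to $B_2$ in $\mathrm{Tam}_n^m$. $m$-statistics of an $m$-ballot path $B$ of size $n$: $\mathrm{mcontacts}(B)$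 is the number of points of $B$ on $y=x/m$ other than the last point; $\mathrm{mrises}(B)$ is the number of initial consecutive vertical steps. For the $i$-th vertical step $u_i$ with starting point $(a,b)$ and $1\le j\le m$, let $\ell_{i,j}$ be the line of slope $1/m$ through $(a,b+j/m)$ and $d_{i,j}$ the maximal portion of $B$ starting at $(a,b+1)$ that stays weakly above $\ell_{i,j}$; $c_{i,j}(B)$ is the number of contacts between $d_{i,j}$ and $\ell_{i,j}$ other than the final one. For the $i$-th horizontal step, $r_i(B)$ is the number of consecutive vertical steps right after it. The $m$-contact vector is $(\mathrm{mcontacts}(B),c_{1,1},\dots,c_{1,m},\dots,c_{n,1},\dots,c_{n,m-1})$ (length $nm$; $c_{n,m}$ omitted) and the $m$-rise vector is $(\mathrm{mrises}(B),r_1,\dots,r_{nm-1})$. $\mathrm{mContactMon}(B,X)=\prod x_{v}$ over the entries $v$ of the $m$-contact vector, $\mathrm{mRiseMon}(B,Y)=\prod y_w$ over the entries $w$ of the $m$-rise vector. For an interval $I=[B_1,B_2]$, $\mathrm{mcontacts}$ and $\mathrm{mContactMon}$ are those of $B_1$, and $\mathrm{mrises}$ and $\mathrm{mRiseMon}$ those of $B_2$. -}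

module Defs where

open import Data.Nat using (ℕ; zero; suc; _+_; _*_; _∸_; _≡ᵇ_; _⊔_)
open import Data.Nat.Properties using (≤-decTotalOrder)
open import Data.Bool using (Bool; true; false; _∧_; _∨_; not; if_then_else_)
open import Data.List using (List; []; _∷_; _++_; map; concatMap; length; take; upTo; filterᵇ; cartesianProduct; foldr)
open import Data.Bool.ListAction using (any)
open import Data.List.Sort.Base using (SortingAlgorithm)
open import Data.Product using (_×_; _,_; proj₁; proj₂)
open import Data.List.Sort.MergeSort ≤-decTotalOrder using (mergeSort)

sortℕ : List ℕ → List ℕ
sortℕ = SortingAlgorithm.sort mergeSort

-- Steps of a lattice path: N = vertical (0,1), E = horizontal (1,0).
data Step : Set where
  N E : Step

Path : Set
Path = List Step

_==ˢ_ : Step → Step → Bool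
N ==ˢ N = true
E ==ˢ E = true
_ ==ˢ _ = false

_==ₚ_ : Path → Path → Bool
[] ==ₚ [] = true
(s ∷ p) ==ₚ (t ∷ q) = (s ==ˢ t) ∧ (p ==ₚ q)
_ ==ₚ _ = false

_∈ᵇ_ : Path → List Path → Bool
p ∈ᵇ ps = any (p ==ₚ_) ps

module _ (m : ℕ) where

  -- Heights are measured as m*y - x (so the line y = x/m is height 0).
  -- aboveFrom h p : starting at height h, p stays weakly above y = x/m
  -- and ends on it.
  aboveFrom : ℕ → Path → Bool
  aboveFrom h [] = h ≡ᵇ 0
  aboveFrom h (N ∷ p) = aboveFrom (h + m) p
  aboveFrom zero (E ∷ p) = false
  aboveFrom (suc h) (E ∷ p) = aboveFrom h p

  countN : Path → ℕ
  countN [] = 0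
  countN (N ∷ p) = suc (countN p)
  countN (E ∷ p) = countN p

  isBallot : ℕ → Path → Bool
  isBallot n p = (countN p ≡ᵇ n) ∧ aboveFrom 0 p

  allPaths : ℕ → List Path
  allPaths zero = [] ∷ []
  allPaths (suc k) = map (N ∷_) (allPaths k) ++ map (E ∷_) (allPaths k)

  ballots : ℕ → List Path
  ballots n = filterᵇ (isBallot n) (allPaths (n * suc m))

  -- primGo h p : split p at the first point where the height (relative
  -- to the starting line, currently h) returns to 0.
  primGo : ℕ → Path → Path × Path
  primGo zero p = [] , p
  primGo (suc h) [] = [] , []
  primGo (suc h) (E ∷ p) = let r = primGo h p in (E ∷ proj₁ r) , proj₂ r
  primGo (suc h) (N ∷ p) = let r = primGo (suc h + m) p in (N ∷ proj₁ r) , proj₂ r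

  -- For a path N ∷ p starting on a line of slope 1/m: split N ∷ p into
  -- (primitive path up to first return to that line, rest).
  primSplitN : Path → Path × Path
  primSplitN p = let r = primGo m p in (N ∷ proj₁ r) , proj₂ r

  rotations : Path → List Path
  rotations [] = []
  rotations (E ∷ N ∷ rest) =
    (let r = primSplitN rest in proj₁ r ++ (E ∷ proj₂ r))
      ∷ map (E ∷_) (rotations (N ∷ rest))
  rotations (s ∷ rest) = map (s ∷_) (rotations rest)

  reach : ℕ → Path → List Path
  reach zero b = b ∷ []
  reach (suc k) b = b ∷ concatMap (reach k) (rotations b)

  module _ (n : ℕ) where
    -- Fuel: any chain of rotations visits distinct elements of Tam_n^m,
    -- so |Tam_n^m| rotations suffice.
    fuel : ℕ
    fuel = length (ballots n)

    leq : Path → Path → Bool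
    leq b₁ b₂ = b₂ ∈ᵇ reach fuel b₁

    lt : Path → Path → Bool
    lt b₁ b₂ = leq b₁ b₂ ∧ not (b₁ ==ₚ b₂)

    covers : Path → Path → Bool
    covers b₁ b₂ = lt b₁ b₂ ∧ not (any (λ c → lt b₁ c ∧ lt c b₂) (ballots n))

    maximum : List ℕ → ℕ
    maximum = foldr _⊔_ 0

    longest : ℕ → Path → Path → ℕ
    longest zero b₁ b₂ = 0
    longest (suc k) b₁ b₂ =
      if b₁ ==ₚ b₂ then 0
      else maximum (map (λ c → suc (longest k c b₂))
                        (filterᵇ (λ c → covers b₁ c ∧ leq c b₂) (ballots n)))

    dist : Path → Path → ℕ
    dist b₁ b₂ = longest fuel b₁ b₂

    intervals : List (Path × Path)
    intervals = filterᵇ (λ I → leq (proj₁ I) (proj₂ I))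
                        (cartesianProduct (ballots n) (ballots n))

  contactsFrom : ℕ → Path → ℕ
  contactsFrom h [] = 0
  contactsFrom zero (N ∷ p) = suc (contactsFrom m p)
  contactsFrom zero (E ∷ p) = suc 0 -- cannot happen for ballot paths
  contactsFrom (suc h) (N ∷ p) = contactsFrom (suc h + m) p
  contactsFrom (suc h) (E ∷ p) = contactsFrom h p

  mcontacts : Path → ℕ
  mcontacts p = contactsFrom 0 p

  mrises : Path → ℕ
  mrises (N ∷ p) = suc (mrises p)
  mrises _ = 0

  -- cnt r p: starting at a point at relative height r above the line ℓ,
  -- follow p while staying weakly above ℓ and count the contacts with ℓ
  -- other than the final one.
  cnt : ℕ → Path → ℕ
  cnt zero [] = 0
  cnt zero (E ∷ _) = 0
  cnt zero (N ∷ p) = suc (cnt m p)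
  cnt (suc r) [] = 0
  cnt (suc r) (E ∷ p) = cnt r p
  cnt (suc r) (N ∷ p) = cnt (suc r + m) p

  afterN : Path → List Path
  afterN [] = []
  afterN (N ∷ p) = p ∷ afterN p
  afterN (E ∷ p) = afterN p

  afterE : Path → List Path
  afterE [] = []
  afterE (E ∷ p) = p ∷ afterE p
  afterE (N ∷ p) = afterE p

  -- c_{i,j}: end of u_i is at relative height m - j above ℓ_{i,j}.
  cVector : Path → List ℕ
  cVector p = concatMap (λ s → map (λ j → cnt (m ∸ suc j) s) (upTo m)) (afterN p)

  dropLast : List ℕ → List ℕ
  dropLast xs = take (length xs ∸ 1) xs

  contactVector : Path → List ℕ
  contactVector p = mcontacts p ∷ dropLast (cVector p)

  riseVector : Path → List ℕ
  riseVector p = mrises p ∷ dropLast (map mrises (afterE p))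

-- A monomial x^a y^b (∏ x_v) (∏ y_w) q^d (the t-degree is fixed
-- separately); the commutative products ∏ x_v, ∏ y_w are recorded by
-- the sorted lists of their indices (i.e. as multisets).
record Monomial : Set where
  constructor mono
  field
    xExp  : ℕ
    yExp  : ℕ
    XIdx  : List ℕ
    YIdx  : List ℕ
    qExp  : ℕ

swapXY : Monomial → Monomial
swapXY (mono a b C R d) = mono b a R C d

intervalMonomial : ℕ → ℕ → Path × Path → Monomial
intervalMonomial m n (b₁ , b₂) =
  mono (mcontacts m b₁) (mrises m b₂)
       (sortℕ (contactVector m b₁)) (sortℕ (riseVector m b₂))
       (dist m n b₁ b₂)

-- Coefficient of t^n in Φ_m(t;x,y,X,Y,q), as the list of monomials
-- (one per interval of Tam_n^m; all coefficients are in ℕ, so the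
-- polynomial is the multiset of these monomials).
PhiCoeff : ℕ → ℕ → List Monomial
PhiCoeff m n = map (intervalMonomial m n) (intervals m n)

{-# OPTIONS --safe #-}

-- A Tamari interval [P, Q] is encoded by a plane forest carrying a label on
-- each node.  Write Q = Q₀ E Q₁ at its first descent to height 0; then P is
-- uniquely A E B P₁ with [A B, Q₀] and [P₁, Q₁] intervals.  The node created by
-- this step has the forest of [P₁, Q₁] as children, that of [A B, Q₀] as right
-- siblings, and m times the number of contacts of A as label.  Up to a factor m,
-- the contacts of P are the labels, the rises of Q are the arities, and (up to a
-- constant depending only on the size) the distance is the total slack of the
-- label bounds.  The forests which occur are those whose arities and labels are
-- all divisible by m.
--
-- For the symmetry, a forest can also be built by an insertion that treats
-- contacts and roots in the opposite way (this is the complement of Tamari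
-- interval-posets); exchanging the two constructions gives an injection on
-- forests that swaps arities with labels and preserves the slack.
module Submission where

open import Defs
open import Data.Bool using (true; false; T; not; _∧_)
open import Data.Bool.ListAction using (any)
open import Data.Bool.Properties using (T-∧; T-≡)
open import Data.Empty using (⊥; ⊥-elim)
open import Data.Fin.Patterns using (0F; 1F; 2F; 3F; 4F)
open import Data.List using (List; []; _∷_; _++_; [_]; map; length; foldr; take; upTo; downFrom; applyUpTo; filterᵇ; cartesianProduct)
open import Data.List.Membership.Propositional using (_∈_; find; lose)
open import Data.List.Membership.Propositional.Properties
open import Data.List.Properties using (++-assoc; ++-identityʳ; ∷-injective; ∷-injectiveʳ; length-++; map-++; map-∘; map-cong; map-id)
open import Data.List.Relation.Binary.Permutation.Propositional using (_↭_; ↭-refl; ↭-trans; ↭-reflexive; prep; ↭-sym; ↭⇒↭ₛ)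
open import Data.List.Relation.Binary.Permutation.Propositional.Properties using (++⁺; ++⁺ˡ; map⁺; shift; ∈-resp-↭; ↭-length; drop-mid; All-resp-↭; ++-commutativeMonoid)
open import Data.List.Relation.Binary.Pointwise using (Pointwise-≡⇒≡)
open import Data.List.Relation.Unary.All as All using (All; []; _∷_)
import Data.List.Relation.Unary.All.Properties as All
open import Data.List.Relation.Unary.AllPairs using ([]; _∷_)
open import Data.List.Relation.Unary.Any as Any using (here; there)
import Data.List.Relation.Unary.Any.Properties as Any
open import Data.List.Relation.Unary.Sorted.TotalOrder.Properties using (↗↭↗⇒≋)
open import Data.List.Relation.Unary.Unique.Propositional using (Unique)
import Data.List.Relation.Unary.Unique.Propositional.Properties as Unique
open import Data.List.Sort.Base using (SortingAlgorithm)
open import Data.Nat using (ℕ; zero; suc; _+_; _*_; _∸_; _≤_; _<_; z≤n; s≤s; _⊔_; _/_; _≡ᵇ_)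
open import Data.Nat.DivMod using (m*n/n≡m)
open import Data.Nat.Divisibility using (_∣_; divides; ∣m+n∣m⇒∣n; m∣m*n; >⇒∤)
open import Data.Nat.Properties
open import Data.List.Sort.MergeSort ≤-decTotalOrder using (mergeSort)
open import Data.Nat.Tactic.RingSolver using (solve-∀)
open import Data.Product using (_×_; _,_; proj₁; proj₂; ∃; ∃₂; Σ-syntax)
open import Data.Sum using (_⊎_; inj₁; inj₂)
open import Data.Unit using (tt)
open import Data.Vec using () renaming ([] to []ᵥ; _∷_ to _∷ᵥ_)
open import Function using (_∘_)
open import Function.Bundles using (module Equivalence)
open import Relation.Binary.PropositionalEquality using (_≡_; _≢_; refl; sym; trans; cong; cong₂; subst; subst₂; module ≡-Reasoning)
open import Relation.Nullary using (¬_)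
open import Relation.Nullary.Decidable using (T?)
import Algebra.Solver.CommutativeMonoid as CommutativeMonoidSolver

open Equivalence using (to; from)

module Bag = CommutativeMonoidSolver (++-commutativeMonoid {A = ℕ})
open Bag using (_⊕_; var)

-- Labelled forests

data Forest : Set where
  ∅    : Forest
  node : (children : Forest) (label : ℕ) (rest : Forest) → Forest

roots contacts slack size : Forest → ℕ
roots ∅ = 0
roots (node A l B) = suc (roots B)

contacts ∅ = 0
contacts (node A l B) = suc (contacts A + (contacts B ∸ l))

slack ∅ = 0
slack (node A l B) = slack A + slack B + (contacts B ∸ l)

size ∅ = 0
size (node A l B) = suc (size A + size B)

labels arities : Forest → List ℕ
labels ∅ = []
labels (node A l B) = l ∷ labels A ++ labels B

arities ∅ = []
arities (node A l B) = roots A ∷ arities A ++ arities B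

-- The label of a node is a number of contacts of its right siblings, which it hides.
data Valid : Forest → Set where
  ∅    : Valid ∅
  node : ∀ {A l B} → Valid A → l ≤ contacts B → Valid B → Valid (node A l B)

-- A new root is inserted after the first k roots of the first forest and adopts
-- the remaining ones; the second forest follows it, with all contacts hidden.
insert : ℕ → Forest → Forest → Forest
insert zero    W            P = node W (contacts P) P
insert (suc k) ∅            P = ∅
insert (suc k) (node A l B) P = node A l (insert k B P)

-- The inserted root leaves `roots (mirror B) ∸ l` roots before it, hence adopts exactly `l`, and it
-- hides the contacts of `mirror A`, which are the roots of `A`: label and arity trade places.
mirror : Forest → Forest
mirror ∅ = ∅
mirror (node A l B) = insert (roots (mirror B) ∸ l) (mirror B) (mirror A)

-- All contacts of `P` are hidden, so the new root adds a single one. It survives each earlier root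
-- because `l ≤ contacts B` makes the truncated subtraction commute with `suc`.
contacts-insert : ∀ k F P → k ≤ roots F → Valid F → contacts (insert k F P) ≡ suc (contacts F)
contacts-insert zero F P _ _ = cong suc (trans (cong (contacts F +_) (n∸n≡0 (contacts P))) (+-identityʳ _))
contacts-insert (suc k) (node A l B) P (s≤s k≤) (node _ l≤ vB) = cong suc (begin
  contacts A + (contacts (insert k B P) ∸ l) ≡⟨ cong (λ z → contacts A + (z ∸ l)) (contacts-insert k B P k≤ vB) ⟩
  contacts A + (suc (contacts B) ∸ l)        ≡⟨ cong (contacts A +_) (+-∸-assoc 1 l≤) ⟩
  contacts A + suc (contacts B ∸ l)          ≡⟨ +-suc _ _ ⟩
  suc (contacts A + (contacts B ∸ l))        ∎)
  where open ≡-Reasoning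

roots-insert : ∀ k F P → k ≤ roots F → roots (insert k F P) ≡ k + suc (roots P)
roots-insert zero F P _ = refl
roots-insert (suc k) (node A l B) P (s≤s k≤) = cong suc (roots-insert k B P k≤)

size-insert : ∀ k F P → k ≤ roots F → size (insert k F P) ≡ suc (size P + size F)
size-insert zero F P _ = cong suc (+-comm (size F) (size P))
size-insert (suc k) (node A l B) P (s≤s k≤) rewrite size-insert k B P k≤ = eq (size A) (size P) (size B)
  where
  eq : ∀ a p b → suc (a + suc (p + b)) ≡ suc (p + suc (a + b))
  eq = solve-∀

-- The new root has slack 0, while each of the `k` roots before it sees one more contact to its
-- right.
slack-insert : ∀ k F P → k ≤ roots F → Valid F → slack (insert k F P) ≡ slack P + slack F + k
slack-insert zero F P _ _ rewrite n∸n≡0 (contacts P) = cong (_+ 0) (+-comm (slack F) (slack P))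
slack-insert (suc k) (node A l B) P (s≤s k≤) (node _ l≤ vB)
  rewrite slack-insert k B P k≤ vB | contacts-insert k B P k≤ vB | +-∸-assoc 1 l≤
  = eq (slack A) (slack P) (slack B) k (contacts B ∸ l)
  where
  eq : ∀ a p b k d → a + (p + b + k) + suc d ≡ p + (a + b + d) + suc k
  eq = solve-∀

labels-insert : ∀ k F P → k ≤ roots F →
  labels (insert k F P) ↭ contacts P ∷ labels P ++ labels F
labels-insert zero F P _ = Bag.prove 3 (var 0F ⊕ (var 1F ⊕ var 2F)) (var 0F ⊕ (var 2F ⊕ var 1F))
  ([ contacts P ] ∷ᵥ labels F ∷ᵥ labels P ∷ᵥ []ᵥ)
labels-insert (suc k) (node A l B) P (s≤s k≤) = ↭-trans
  (prep l (++⁺ˡ (labels A) (labels-insert k B P k≤)))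
  (Bag.prove 5 (var 0F ⊕ (var 1F ⊕ (var 2F ⊕ (var 3F ⊕ var 4F))))
               (var 2F ⊕ (var 3F ⊕ (var 0F ⊕ (var 1F ⊕ var 4F))))
    ([ l ] ∷ᵥ labels A ∷ᵥ [ contacts P ] ∷ᵥ labels P ∷ᵥ labels B ∷ᵥ []ᵥ))

arities-insert : ∀ k F P → k ≤ roots F →
  arities (insert k F P) ↭ (roots F ∸ k) ∷ arities P ++ arities F
arities-insert zero F P _ = Bag.prove 3 (var 0F ⊕ (var 1F ⊕ var 2F)) (var 0F ⊕ (var 2F ⊕ var 1F))
  ([ roots F ] ∷ᵥ arities F ∷ᵥ arities P ∷ᵥ []ᵥ)
arities-insert (suc k) (node A l B) P (s≤s k≤) = ↭-trans
  (prep (roots A) (++⁺ˡ (arities A) (arities-insert k B P k≤)))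
  (Bag.prove 5 (var 0F ⊕ (var 1F ⊕ (var 2F ⊕ (var 3F ⊕ var 4F))))
               (var 2F ⊕ (var 3F ⊕ (var 0F ⊕ (var 1F ⊕ var 4F))))
    ([ roots A ] ∷ᵥ arities A ∷ᵥ [ roots B ∸ k ] ∷ᵥ arities P ∷ᵥ arities B ∷ᵥ []ᵥ))

valid-insert : ∀ k F P → k ≤ roots F → Valid F → Valid P → Valid (insert k F P)
valid-insert zero F P _ vF vP = node vF ≤-refl vP
valid-insert (suc k) (node A l B) P (s≤s k≤) (node vA l≤ vB) vP =
  node vA (subst (l ≤_) (sym (contacts-insert k B P k≤ vB)) (m≤n⇒m≤1+n l≤)) (valid-insert k B P k≤ vB vP)

node-injective : ∀ {A l B A' l' B'} → Forest.node A l B ≡ node A' l' B' → A ≡ A' × l ≡ l' × B ≡ B'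
node-injective refl = refl , refl , refl

-- The inserted root is the first one whose label uses up all the contacts
-- to its right, so it can be recovered from the result.
insert-injective : ∀ k F P k' F' P' → k ≤ roots F → k' ≤ roots F' → Valid F → Valid F' →
  insert k F P ≡ insert k' F' P' → k ≡ k' × F ≡ F' × P ≡ P'
insert-injective zero F P zero F' P' _ _ _ _ e with node-injective e
... | refl , _ , refl = refl , refl , refl
insert-injective zero F P (suc k') (node A l B) P' _ (s≤s k≤) _ (node _ l≤ vB) e with node-injective e
... | refl , refl , refl = ⊥-elim (1+n≰n (subst (_≤ contacts B) (contacts-insert k' B P' k≤ vB) l≤))
insert-injective (suc k) (node A l B) P zero F' P' (s≤s k≤) _ (node _ l≤ vB) _ e with node-injective e
... | refl , refl , refl = ⊥-elim (1+n≰n (subst (_≤ contacts B) (contacts-insert k B P k≤ vB) l≤))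
insert-injective (suc k) (node A l B) P (suc k') (node A' l' B') P' (s≤s k≤) (s≤s k'≤) (node _ _ vB) (node _ _ vB') e
  with node-injective e
... | refl , refl , e' with insert-injective k B P k' B' P' k≤ k'≤ vB vB' e'
... | refl , refl , refl = refl , refl , refl

-- Statistics exchanged by the mirror

record Mirrored (F G : Forest) : Set where
  field
    valid     : Valid G
    roots≡    : roots G ≡ contacts F
    contacts≡ : contacts G ≡ roots F
    slack≡    : slack G ≡ slack F
    size≡     : size G ≡ size F
    labels↭   : labels G ↭ arities F
    arities↭  : arities G ↭ labels F

open Mirrored

mirrored : ∀ {F} → Valid F → Mirrored F (mirror F)
mirrored ∅ = record { valid = ∅ ; roots≡ = refl ; contacts≡ = refl ; slack≡ = refl ; size≡ = refl
                    ; labels↭ = ↭-refl ; arities↭ = ↭-refl }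
mirrored {node A l B} (node vA l≤ vB) = record
  { valid     = valid-insert k (mirror B) (mirror A) k≤ (valid b) (valid a)
  ; roots≡    = trans (roots-insert k (mirror B) (mirror A) k≤)
                (trans (cong₂ (λ x y → (x ∸ l) + suc y) (roots≡ b) (roots≡ a))
                (+-comm (contacts B ∸ l) (suc (contacts A))))
  ; contacts≡ = trans (contacts-insert k (mirror B) (mirror A) k≤ (valid b)) (cong suc (contacts≡ b))
  ; slack≡    = trans (slack-insert k (mirror B) (mirror A) k≤ (valid b))
                (cong₂ _+_ (cong₂ _+_ (slack≡ a) (slack≡ b)) (cong (_∸ l) (roots≡ b)))
  ; size≡     = trans (size-insert k (mirror B) (mirror A) k≤)
                (cong suc (cong₂ _+_ (size≡ a) (size≡ b)))
  ; labels↭   = ↭-trans (labels-insert k (mirror B) (mirror A) k≤)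
                (++⁺ (↭-reflexive (cong [_] (contacts≡ a))) (++⁺ (labels↭ a) (labels↭ b)))
  ; arities↭  = ↭-trans (arities-insert k (mirror B) (mirror A) k≤)
                (++⁺ (↭-reflexive (cong [_] (m∸[m∸n]≡n l≤r))) (++⁺ (arities↭ a) (arities↭ b)))
  }
  where
  a = mirrored vA
  b = mirrored vB
  k = roots (mirror B) ∸ l
  k≤ : k ≤ roots (mirror B)
  k≤ = m∸n≤m (roots (mirror B)) l
  l≤r : l ≤ roots (mirror B)
  l≤r = subst (l ≤_) (sym (roots≡ b)) l≤

insert≢∅ : ∀ k F P → k ≤ roots F → insert k F P ≡ ∅ → ⊥
insert≢∅ zero F P _ ()
insert≢∅ (suc k) (node A l B) P _ ()

-- Undoing the insertion recovers both mirrored subforests and the number of roots before the new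
-- one; within the valid range of labels that number determines `l`.
mirror-injective : ∀ {F G} → Valid F → Valid G → mirror F ≡ mirror G → F ≡ G
mirror-injective ∅ ∅ _ = refl
mirror-injective ∅ (node {A} {l} {B} _ _ _) e =
  ⊥-elim (insert≢∅ _ (mirror B) (mirror A) (m∸n≤m (roots (mirror B)) l) (sym e))
mirror-injective (node {A} {l} {B} _ _ _) ∅ e =
  ⊥-elim (insert≢∅ _ (mirror B) (mirror A) (m∸n≤m (roots (mirror B)) l) e)
mirror-injective (node {A} {l} {B} vA l≤ vB) (node {A'} {l'} {B'} vA' l'≤ vB') e
  with insert-injective _ (mirror B) (mirror A) _ (mirror B') (mirror A')
         (m∸n≤m (roots (mirror B)) l) (m∸n≤m (roots (mirror B')) l')
         (valid (mirrored vB)) (valid (mirrored vB')) e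
... | k≡ , eB , eA with mirror-injective vA vA' eA | mirror-injective vB vB' eB
... | refl | refl = cong (λ l → node A l B) (∸-cancelˡ-≡ (l≤r l≤) (l≤r l'≤) k≡)
  where
  l≤r : ∀ {l} → l ≤ contacts B → l ≤ roots (mirror B)
  l≤r {l} = subst (l ≤_) (sym (roots≡ (mirrored vB)))

-- Lists, multisets and paths

map-upTo≡map-downFrom : ∀ {A : Set} (f : ℕ → A) n → map (λ j → f (n ∸ suc j)) (upTo n) ≡ map f (downFrom n)
map-upTo≡map-downFrom f n = trans (go (λ j → f (n ∸ suc j)) (λ j → j) n) (go' n)
  where
  go : ∀ {A : Set} (f : ℕ → A) (g : ℕ → ℕ) n → map f (applyUpTo g n) ≡ applyUpTo (λ j → f (g j)) n
  go f g zero = refl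
  go f g (suc n) = cong (f (g 0) ∷_) (go f (λ j → g (suc j)) n)
  go' : ∀ n → applyUpTo (λ j → f (n ∸ suc j)) n ≡ map f (downFrom n)
  go' zero = refl
  go' (suc n) = cong (f n ∷_) (go' n)

mrises-++E : ∀ m A B → mrises m (A ++ E ∷ B) ≡ mrises m A
mrises-++E m [] B = refl
mrises-++E m (N ∷ A) B = cong suc (mrises-++E m A B)
mrises-++E m (E ∷ A) B = refl

risesAfter : ℕ → Path → List ℕ
risesAfter m Q = map (mrises m) (afterE m Q)

risesAfter-++E : ∀ m A B → risesAfter m (A ++ E ∷ B) ≡ risesAfter m A ++ mrises m B ∷ risesAfter m B
risesAfter-++E m [] B = refl
risesAfter-++E m (N ∷ A) B = risesAfter-++E m A B
risesAfter-++E m (E ∷ A) B = cong₂ _∷_ (mrises-++E m A B) (risesAfter-++E m A B)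

countN-++ : ∀ m A B → countN m (A ++ B) ≡ countN m A + countN m B
countN-++ m [] B = refl
countN-++ m (N ∷ A) B = cong suc (countN-++ m A B)
countN-++ m (E ∷ A) B = countN-++ m A B

append-unique : ∀ (A : Path) {B A′ B′} → length A ≡ length A′ → A ++ B ≡ A′ ++ B′ → A ≡ A′ × B ≡ B′
append-unique [] {A′ = []} _ e = refl , e
append-unique (x ∷ A) {A′ = y ∷ A′} l e with ∷-injective e
... | refl , e′ with append-unique A {A′ = A′} (suc-injective l) e′
... | refl , e″ = refl , e″

unique-complement : ∀ {A : Set} {xs ys : List A} → Unique xs → (∀ {x} → x ∈ xs → x ∈ ys) → ∃ λ zs → ys ↭ xs ++ zs
unique-complement {ys = ys} [] _ = ys , ↭-refl
unique-complement {xs = x ∷ xs} {ys} (x∉ ∷ u) sub with ∈-∃++ (sub (here refl))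
... | as , bs , refl with unique-complement {ys = as ++ bs} u rest
  where
  rest : ∀ {y} → y ∈ xs → y ∈ as ++ bs
  rest y∈ with ∈-resp-↭ (shift x as bs) (sub (there y∈))
  ... | here refl = ⊥-elim (All.lookup x∉ y∈ refl)
  ... | there p = p
... | zs , p = zs , ↭-trans (shift x as bs) (prep x p)

unique-length-≤ : ∀ {A : Set} {xs ys : List A} → Unique xs → (∀ {x} → x ∈ xs → x ∈ ys) → length xs ≤ length ys
unique-length-≤ {xs = xs} u sub with unique-complement u sub
... | zs , p = subst (length xs ≤_) (sym (trans (↭-length p) (length-++ xs))) (m≤m+n _ _)

module _ {A B : Set} (f g : A → B) (R : A → A → Set) (injective : ∀ {x x′ y} → R x y → R x′ y → x ≡ x′) where

  private
    matches : ∀ {xs} zs → Unique zs → (∀ {x} → x ∈ zs → ∃ λ y → y ∈ xs × R x y × f y ≡ g x) →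
      ∃ λ ys → length ys ≡ length zs × Unique ys × (∀ {y} → y ∈ ys → y ∈ xs × ∃ λ x → x ∈ zs × R x y) × map f ys ≡ map g zs
    matches [] _ _ = [] , refl , [] , (λ ()) , refl
    matches (z ∷ zs) (z∉ ∷ u) match with match (here refl) | matches zs u (match ∘ there)
    ... | y , y∈ , r , e | ys , l , u′ , back , e′ =
      y ∷ ys , cong suc l , All.tabulate fresh ∷ u′ , back′ , cong₂ _∷_ e e′
      where
      fresh : ∀ {y′} → y′ ∈ ys → y ≢ y′
      fresh y′∈ refl with back y′∈
      ... | _ , x , x∈ , r′ = All.lookup z∉ x∈ (injective r r′)
      back′ : ∀ {y′} → y′ ∈ y ∷ ys → _ × ∃ λ x → x ∈ z ∷ zs × R x y′
      back′ (here refl) = y∈ , z , here refl , r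
      back′ (there p) with back p
      ... | q , x , x∈ , r′ = q , x , there x∈ , r′

  -- An injective self-map of a finite set is onto: the list of partners is duplicate-free,
  -- contained in `xs` and as long as `xs`, so its complement is empty.
  map-↭-matching : ∀ {xs} → Unique xs → (∀ {x} → x ∈ xs → ∃ λ y → y ∈ xs × R x y × f y ≡ g x) → map f xs ↭ map g xs
  map-↭-matching {xs} u match with matches xs u match
  ... | ys , l , u′ , back , e with unique-complement u′ (proj₁ ∘ back)
  ... | [] , p = ↭-trans (map⁺ f p) (↭-reflexive (trans (cong (map f) (++-identityʳ ys)) e))
  ... | z ∷ zs , p = ⊥-elim (m+1+n≢m (length ys)
    (trans (sym (length-++ ys)) (trans (sym (↭-length p)) (sym l))))

sortℕ-↭ : ∀ {xs ys} → xs ↭ ys → sortℕ xs ≡ sortℕ ys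
sortℕ-↭ {xs} {ys} p = Pointwise-≡⇒≡ (↗↭↗⇒≋ ≤-totalOrder (sort-↗ xs) (sort-↗ ys)
  (↭⇒↭ₛ (↭-trans (sort-↭ xs) (↭-trans p (↭-sym (sort-↭ ys))))))
  where open SortingAlgorithm mergeSort

mono-cong : ∀ {a a′ b b′ C C′ R R′ d d′} → a ≡ a′ → b ≡ b′ → C ≡ C′ → R ≡ R′ → d ≡ d′ →
  mono a b C R d ≡ mono a′ b′ C′ R′ d′
mono-cong refl refl refl refl refl = refl

-- The contact and rise vectors omit the last entry of a longer list. As that entry is 0 in both
-- cases, a permutation of the full lists restricts to the truncated ones.
EndsInZero : List ℕ → Set
EndsInZero xs = xs ≡ [] ⊎ ∃ λ ys → xs ≡ ys ++ 0 ∷ []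

prepend-EndsInZero : ∀ xs {ys} → ∃ (λ zs → ys ≡ zs ++ 0 ∷ []) → ∃ λ zs → xs ++ ys ≡ zs ++ 0 ∷ []
prepend-EndsInZero xs (zs , refl) = xs ++ zs , sym (++-assoc xs zs (0 ∷ []))

dropLast-∷ʳ : ∀ m xs x → dropLast m (xs ++ x ∷ []) ≡ xs
dropLast-∷ʳ m xs x = trans
  (cong (λ k → take k (xs ++ x ∷ [])) (trans (cong (_∸ 1) (length-++ xs)) (m+n∸n≡m (length xs) 1)))
  (take-length xs)
  where
  take-length : ∀ ys → take (length ys) (ys ++ x ∷ []) ≡ ys
  take-length [] = refl
  take-length (y ∷ ys) = cong (y ∷_) (take-length ys)

dropLast-↭ : ∀ m {xs ys} → EndsInZero xs → EndsInZero ys → xs ↭ ys → dropLast m xs ↭ dropLast m ys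
dropLast-↭ m (inj₁ refl) (inj₁ refl) _ = ↭-refl
dropLast-↭ m (inj₁ refl) (inj₂ (ys , refl)) p = ⊥-elim (m+1+n≢0 (length ys) (trans (sym (length-++ ys)) (sym (↭-length p))))
dropLast-↭ m (inj₂ (xs , refl)) (inj₁ refl) p = ⊥-elim (m+1+n≢0 (length xs) (trans (sym (length-++ xs)) (↭-length p)))
dropLast-↭ m (inj₂ (xs , refl)) (inj₂ (ys , refl)) p
  rewrite dropLast-∷ʳ m xs 0 | dropLast-∷ʳ m ys 0 =
  subst₂ _↭_ (++-identityʳ xs) (++-identityʳ ys) (drop-mid xs ys p)

*-map-↭ : ∀ k {xs ys} → map (suc k *_) xs ↭ map (suc k *_) ys → xs ↭ ys
*-map-↭ k {xs} {ys} p = subst₂ _↭_ (undo xs) (undo ys) (map⁺ (_/ suc k) p)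
  where
  undo : ∀ zs → map (_/ suc k) (map (suc k *_) zs) ≡ zs
  undo zs = trans (sym (map-∘ zs)) (trans (map-cong (λ z → trans (cong (_/ suc k) (*-comm (suc k) z)) (m*n/n≡m z (suc k))) zs) (map-id zs))

==ₚ⇒≡ : ∀ p q → T (p ==ₚ q) → p ≡ q
==ₚ⇒≡ [] [] _ = refl
==ₚ⇒≡ (N ∷ p) (N ∷ q) t = cong (N ∷_) (==ₚ⇒≡ p q t)
==ₚ⇒≡ (E ∷ p) (E ∷ q) t = cong (E ∷_) (==ₚ⇒≡ p q t)

==ₚ-refl : ∀ p → T (p ==ₚ p)
==ₚ-refl [] = tt
==ₚ-refl (N ∷ p) = ==ₚ-refl p
==ₚ-refl (E ∷ p) = ==ₚ-refl p

T-not⁺ : ∀ {b} → ¬ T b → T (not b)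
T-not⁺ {false} _ = tt
T-not⁺ {true} f = f tt

T-not⁻ : ∀ {b} → T (not b) → ¬ T b
T-not⁻ {false} _ t = t

∈ᵇ⁻ : ∀ p ps → T (p ∈ᵇ ps) → p ∈ ps
∈ᵇ⁻ p ps t = Any.map (==ₚ⇒≡ p _) (Any.any⁻ (p ==ₚ_) ps t)

∈ᵇ⁺ : ∀ {p ps} → p ∈ ps → T (p ∈ᵇ ps)
∈ᵇ⁺ {p} p∈ = Any.any⁺ (p ==ₚ_) (Any.map (λ { refl → ==ₚ-refl p }) p∈)

≤-foldr-⊔ : ∀ {x xs} → x ∈ xs → x ≤ foldr _⊔_ 0 xs
≤-foldr-⊔ (here refl) = m≤m⊔n _ _
≤-foldr-⊔ {xs = y ∷ _} (there p) = ≤-trans (≤-foldr-⊔ p) (m≤n⊔m y _)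

foldr-⊔-≤ : ∀ {b} xs → (∀ {x} → x ∈ xs → x ≤ b) → foldr _⊔_ 0 xs ≤ b
foldr-⊔-≤ [] _ = z≤n
foldr-⊔-≤ (x ∷ xs) f = ⊔-lub (f (here refl)) (foldr-⊔-≤ xs (f ∘ there))

∈-allPaths : ∀ m P → P ∈ allPaths m (length P)
∈-allPaths m [] = here refl
∈-allPaths m (N ∷ P) = ∈-++⁺ˡ (∈-map⁺ (N ∷_) (∈-allPaths m P))
∈-allPaths m (E ∷ P) = ∈-++⁺ʳ (map (N ∷_) (allPaths m (length P))) (∈-map⁺ (E ∷_) (∈-allPaths m P))

unique-allPaths : ∀ m k → Unique (allPaths m k)
unique-allPaths m zero = [] ∷ []
unique-allPaths m (suc k) = Unique.++⁺ (Unique.map⁺ ∷-injectiveʳ (unique-allPaths m k))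
  (Unique.map⁺ ∷-injectiveʳ (unique-allPaths m k)) disjoint
  where
  disjoint : ∀ {P} → P ∈ map (N ∷_) (allPaths m k) × P ∈ map (E ∷_) (allPaths m k) → ⊥
  disjoint (p , q) with ∈-map⁻ (N ∷_) p | ∈-map⁻ (E ∷_) q
  ... | _ , _ , refl | _ , _ , ()

unique-ballots : ∀ m n → Unique (ballots m n)
unique-ballots m n = Unique.filter⁺ (T? ∘ isBallot m n) (unique-allPaths m (n * suc m))

module Tamari (m′ : ℕ) where

  m : ℕ
  m = suc m′

  -- Intervals and their forests

  -- Heights are values of `m*y - x`, as in `aboveFrom`. Since `east` starts at a successor, staying
  -- weakly above height 0 is built in.
  data Walk : ℕ → Path → ℕ → Set where
    done  : ∀ {h} → Walk h [] h
    north : ∀ {h P k} → Walk (h + m) P k → Walk h (N ∷ P) k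
    east  : ∀ {h P k} → Walk h P k → Walk (suc h) (E ∷ P) k

  walk-++ : ∀ {a P b Q c} → Walk a P b → Walk b Q c → Walk a (P ++ Q) c
  walk-++ done v = v
  walk-++ (north w) v = north (walk-++ w v)
  walk-++ (east w) v = east (walk-++ w v)

  walk-shift : ∀ {a P b} → Walk a P b → Walk (suc a) P (suc b)
  walk-shift done = done
  walk-shift (north w) = north (walk-shift w)
  walk-shift (east w) = east (walk-shift w)

  walk-cancelˡ : ∀ {a P b Q c} → Walk a P b → Walk a (P ++ Q) c → Walk b Q c
  walk-cancelˡ done v = v
  walk-cancelˡ (north w) (north v) = walk-cancelˡ w v
  walk-cancelˡ (east w) (east v) = walk-cancelˡ w v

  walk-++E : ∀ {h P Q} → Walk h P 0 → Walk 0 Q 0 → Walk (suc h) (P ++ E ∷ Q) 0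
  walk-++E w v = walk-++ (walk-shift w) (east v)

  -- The distinguished `E` is the first step below height 0, so its position depends on the path
  -- alone.
  split-++E : ∀ {h P Q P′ Q′} → Walk h P 0 → Walk h P′ 0 → P ++ E ∷ Q ≡ P′ ++ E ∷ Q′ → P ≡ P′ × Q ≡ Q′
  split-++E done done refl = refl , refl
  split-++E done (north v) ()
  split-++E (north w) done ()
  split-++E (north w) (north v) e with split-++E w v (∷-injectiveʳ e)
  ... | refl , q = refl , q
  split-++E (north w) (east v) ()
  split-++E (east w) (north v) ()
  split-++E (east w) (east v) e with split-++E w v (∷-injectiveʳ e)
  ... | refl , q = refl , q

  cnt-++ : ∀ {h P} Q → Walk h P 0 → cnt m h (P ++ Q) ≡ cnt m h P + cnt m 0 Q
  cnt-++ Q done = refl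
  cnt-++ Q (north {zero} w) = cong suc (cnt-++ Q w)
  cnt-++ Q (north {suc h} w) = cnt-++ Q w
  cnt-++ Q (east w) = cnt-++ Q w

  cnt-++E : ∀ {h P} Q → Walk h P 0 → cnt m h (P ++ E ∷ Q) ≡ cnt m h P
  cnt-++E Q w = trans (cnt-++ (E ∷ Q) w) (+-identityʳ _)

  -- The line lies at height `a - h > 0`, above the end of `P`, so the count stops inside `P`.
  cnt-prefix : ∀ {a h P} Q → Walk a P 0 → h < a → cnt m h (P ++ Q) ≡ cnt m h P
  cnt-prefix {h = zero} Q (north w) h< = cong suc (cnt-prefix Q w (+-monoˡ-< m h<))
  cnt-prefix {h = suc h} Q (north w) h< = cnt-prefix Q w (+-monoˡ-< m h<)
  cnt-prefix {h = zero} Q (east w) _ = refl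
  cnt-prefix {h = suc h} Q (east w) (s≤s h<) = cnt-prefix Q w h<

  -- The line runs one unit below height 0 of the walk, so `P` never meets it.
  cnt-raised : ∀ {a P b} Q → Walk a P b → cnt m (suc a) (P ++ Q) ≡ cnt m (suc b) Q
  cnt-raised Q done = refl
  cnt-raised Q (north w) = cnt-raised Q w
  cnt-raised Q (east w) = cnt-raised Q w

  contactsFrom≡cnt : ∀ {h P} → Walk h P 0 → contactsFrom m h P ≡ cnt m h P
  contactsFrom≡cnt done = refl
  contactsFrom≡cnt (north {zero} w) = cong suc (contactsFrom≡cnt w)
  contactsFrom≡cnt (north {suc h} w) = contactsFrom≡cnt w
  contactsFrom≡cnt (east w) = contactsFrom≡cnt w

  -- Among the prefixes ending at height 0, a longer one has strictly more contacts, so the number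
  -- of contacts fixes the cut.
  split-contact : ∀ {h P Q P′ Q′} → Walk h P 0 → Walk h P′ 0 → Walk 0 Q 0 → Walk 0 Q′ 0 →
    cnt m h P ≡ cnt m h P′ → P ++ Q ≡ P′ ++ Q′ → P ≡ P′ × Q ≡ Q′
  split-contact done done _ _ _ e = refl , e
  split-contact done (north v) _ _ () e
  split-contact (north w) done _ _ () e
  split-contact (north {zero} w) (north v) q q′ c e with split-contact w v q q′ (suc-injective c) (∷-injectiveʳ e)
  ... | refl , e′ = refl , e′
  split-contact (north {suc h} w) (north v) q q′ c e with split-contact w v q q′ c (∷-injectiveʳ e)
  ... | refl , e′ = refl , e′
  split-contact (north w) (east v) _ _ _ ()
  split-contact (east w) (north v) _ _ _ ()
  split-contact (east w) (east v) q q′ c e with split-contact w v q q′ c (∷-injectiveʳ e)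
  ... | refl , e′ = refl , e′

  contact-split : ∀ {h P} l → Walk h P 0 → l ≤ cnt m h P →
    Σ[ A ∈ Path ] Σ[ B ∈ Path ] Walk h A 0 × Walk 0 B 0 × P ≡ A ++ B × cnt m h A ≡ l
  contact-split l done z≤n = [] , [] , done , done , refl , refl
  contact-split zero (north {zero} {P} w) _ = [] , N ∷ P , done , north w , refl , refl
  contact-split (suc l) (north {zero} w) (s≤s l≤) with contact-split l w l≤
  ... | A , B , a , b , refl , c = N ∷ A , B , north a , b , refl , cong suc c
  contact-split l (north {suc h} w) l≤ with contact-split l w l≤
  ... | A , B , a , b , refl , c = N ∷ A , B , north a , b , refl , c
  contact-split l (east w) l≤ with contact-split l w l≤
  ... | A , B , a , b , refl , c = E ∷ A , B , east a , b , refl , c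

  cVector-++ : ∀ {h P} Q → Walk h P 0 → cVector m (P ++ Q) ≡ cVector m P ++ cVector m Q
  cVector-++ Q done = refl
  cVector-++ Q (north {h} {P} w) = trans
    (cong₂ _++_ (map-cong (λ j → cnt-prefix Q w (<-≤-trans (s≤s (m∸n≤m m′ j)) (m≤n+m m h))) (upTo m)) (cVector-++ Q w))
    (sym (++-assoc (map (λ j → cnt m (m ∸ suc j) P) (upTo m)) (cVector m P) (cVector m Q)))
  cVector-++ Q (east w) = cVector-++ Q w

  -- The paths of an interval start at a common height h and end at height 0.
  data Interval : ℕ → Path → Path → Set where
    nil : Interval 0 [] []
    up  : ∀ {P Q} → Interval m P Q → Interval 0 (N ∷ P) (N ∷ Q)
    down  : ∀ {h P Q P₀ Q₀ P₁ Q₁} A B → Walk h A 0 → Walk 0 B 0 → P₀ ≡ A ++ B →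
          Interval h P₀ Q₀ → Interval 0 P₁ Q₁ → P ≡ A ++ E ∷ B ++ P₁ → Q ≡ Q₀ ++ E ∷ Q₁ → Interval (suc h) P Q

  lower-walk : ∀ {h P Q} → Interval h P Q → Walk h P 0
  lower-walk nil = done
  lower-walk (up I) = north (lower-walk I)
  lower-walk (down A B a b _ I J refl _) = walk-++E a (walk-++ b (lower-walk J))

  upper-walk : ∀ {h P Q} → Interval h P Q → Walk h Q 0
  upper-walk nil = done
  upper-walk (up I) = north (upper-walk I)
  upper-walk (down A B a b _ I J _ refl) = walk-++E (upper-walk I) (upper-walk J)

  -- This will be the distance. `B` is a sequence of `cnt m 0 B` primitive paths; moving `E` past
  -- them one at a time leads from `A E B P₁` to `A B E P₁`, and the two smaller intervals account
  -- for the rest.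
  depth : ∀ {h P Q} → Interval h P Q → ℕ
  depth nil = 0
  depth (up I) = depth I
  depth (down A B a b _ I J _ _) = depth I + depth J + cnt m 0 B

  -- Only horizontal steps create nodes. An `up` merely turns starting height `m` into 0, so the
  -- forest sees the starting height only modulo `m`.
  forest : ∀ {h P Q} → Interval h P Q → Forest
  forest nil = ∅
  forest (up I) = forest I
  forest (down {h} A B a b _ I J _ _) = node (forest J) (m * cnt m h A) (forest I)

  countN-down : ∀ A B P → countN m (A ++ E ∷ B ++ P) ≡ countN m (A ++ B) + countN m P
  countN-down A B P = begin
    countN m (A ++ E ∷ B ++ P)               ≡⟨ countN-++ m A (E ∷ B ++ P) ⟩
    countN m A + countN m (B ++ P)           ≡⟨ cong (countN m A +_) (countN-++ m B P) ⟩
    countN m A + (countN m B + countN m P)   ≡⟨ +-assoc (countN m A) (countN m B) (countN m P) ⟨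
    countN m A + countN m B + countN m P     ≡⟨ cong (_+ countN m P) (countN-++ m A B) ⟨
    countN m (A ++ B) + countN m P           ∎
    where open ≡-Reasoning

  same-size : ∀ {h P Q} → Interval h P Q → countN m P ≡ countN m Q
  same-size nil = refl
  same-size (up I) = cong suc (same-size I)
  same-size (down {Q₀ = Q₀} {P₁ = P₁} {Q₁ = Q₁} A B a b refl I J refl refl) =
    trans (countN-down A B P₁) (trans (cong₂ _+_ (same-size I) (same-size J)) (sym (countN-++ m Q₀ (E ∷ Q₁))))

  -- Scaled by m, the bound on a label created at height h exceeds a multiple of m by h;
  -- these excesses add up to tri m for every vertical step.
  tri : ℕ → ℕ
  tri zero = 0
  tri (suc h) = h + tri h

  size-forest : ∀ {h P Q} (I : Interval h P Q) → size (forest I) ≡ h + m * countN m P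
  size-forest nil = sym (*-zeroʳ m)
  size-forest (up {P} I) = trans (size-forest I) (sym (*-suc m (countN m P)))
  size-forest (down {h} {P₁ = P₁} A B a b refl I J refl _)
    rewrite size-forest I | size-forest J | countN-down A B P₁ = eq h m (countN m (A ++ B)) (countN m P₁)
    where
    eq : ∀ h m x y → suc (m * y + (h + m * x)) ≡ suc h + m * (x + y)
    eq = solve-∀

  roots-forest : ∀ {h P Q} (I : Interval h P Q) → roots (forest I) ≡ h + m * mrises m Q
  roots-forest nil = sym (*-zeroʳ m)
  roots-forest (up {Q = Q} I) = trans (roots-forest I) (sym (*-suc m (mrises m Q)))
  roots-forest (down {h} {Q₀ = Q₀} {Q₁ = Q₁} A B a b refl I J _ refl) =
    cong suc (trans (roots-forest I) (cong (λ z → h + m * z) (sym (mrises-++E m Q₀ Q₁))))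

  contacts∸ : ∀ h x y → (m * (x + y) + h) ∸ m * x ≡ m * y + h
  contacts∸ h x y = begin
    (m * (x + y) + h) ∸ m * x     ≡⟨ cong (_∸ m * x) (eq h m x y) ⟩
    (m * x + (m * y + h)) ∸ m * x ≡⟨ m+n∸m≡n (m * x) _ ⟩
    m * y + h                     ∎
    where
    open ≡-Reasoning
    eq : ∀ h m x y → m * (x + y) + h ≡ m * x + (m * y + h)
    eq = solve-∀

  contacts-forest : ∀ {h P Q} (I : Interval h P Q) → contacts (forest I) ≡ m * cnt m h P + h
  contacts-forest-∸ : ∀ {h A B Q} (I : Interval h (A ++ B) Q) → Walk h A 0 →
    contacts (forest I) ∸ m * cnt m h A ≡ m * cnt m 0 B + h

  contacts-forest nil = sym (trans (+-identityʳ (m * 0)) (*-zeroʳ m))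
  contacts-forest (up {P} I) = trans (contacts-forest I) (eq m (cnt m m P))
    where
    eq : ∀ m c → m * c + m ≡ m * suc c + 0
    eq = solve-∀
  contacts-forest (down {h} {P₁ = P₁} A B a b refl I J refl _)
    rewrite contacts-forest-∸ {B = B} I a | contacts-forest J
          | cnt-raised (E ∷ B ++ P₁) a | cnt-++ P₁ b
    = eq h m (cnt m 0 B) (cnt m 0 P₁)
    where
    eq : ∀ h m x y → suc (m * y + 0 + (m * x + h)) ≡ m * (x + y) + suc h
    eq = solve-∀

  contacts-forest-∸ {h} {A} {B} I a rewrite contacts-forest I | cnt-++ B a = contacts∸ h (cnt m h A) (cnt m 0 B)

  valid-forest : ∀ {h P Q} (I : Interval h P Q) → Valid (forest I)
  valid-forest nil = ∅
  valid-forest (up I) = valid-forest I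
  valid-forest (down {h} A B a b refl I J _ _) = node (valid-forest J) le (valid-forest I)
    where
    le : m * cnt m h A ≤ contacts (forest I)
    le rewrite contacts-forest I | cnt-++ B a =
      ≤-trans (*-monoʳ-≤ m (m≤m+n (cnt m h A) (cnt m 0 B))) (m≤m+n _ h)

  slack-forest : ∀ {h P Q} (I : Interval h P Q) →
    slack (forest I) ≡ m * depth I + countN m P * tri m + tri h
  slack-forest nil = sym (trans (+-identityʳ _) (trans (+-identityʳ (m * 0)) (*-zeroʳ m)))
  slack-forest (up {P} I) = trans (slack-forest I) (eq (m * depth I) (countN m P) (tri m))
    where
    eq : ∀ d c t → d + c * t + t ≡ d + suc c * t + 0
    eq = solve-∀
  slack-forest (down {h} {P₁ = P₁} A B a b refl I J refl _)
    rewrite contacts-forest-∸ {B = B} I a | slack-forest I | slack-forest J | countN-down A B P₁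
    = eq m h (depth I) (depth J) (countN m (A ++ B)) (countN m P₁) (cnt m 0 B) (tri m) (tri h)
    where
    eq : ∀ m h d e x y b s t →
      (m * e + y * s + 0) + (m * d + x * s + t) + (m * b + h) ≡ m * (d + e + b) + (x + y) * s + (h + t)
    eq = solve-∀

  -- The entries c_{i,j} of the step that led to the starting height h.
  openLabels : ℕ → Path → List ℕ
  openLabels h P = map (λ j → cnt m j P) (downFrom h)

  openLabels-prefix : ∀ {a P} Q h → h ≤ a → Walk a P 0 → openLabels h (P ++ Q) ≡ openLabels h P
  openLabels-prefix Q zero _ w = refl
  openLabels-prefix Q (suc h) h< w = cong₂ _∷_ (cnt-prefix Q w h<) (openLabels-prefix Q h (<⇒≤ h<) w)

  cVector-N : ∀ P → cVector m (N ∷ P) ≡ openLabels m P ++ cVector m P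
  cVector-N P = cong (_++ cVector m P) (map-upTo≡map-downFrom (λ j → cnt m j P) m)

  -- In the case `down`, the line of the first open label is at height 1 and is left at the
  -- distinguished `E`, which gives the contacts of `A`. The other open lines are higher and are
  -- left inside `A`, so they do not see what follows.
  labels-forest : ∀ {h P Q} (I : Interval h P Q) →
    labels (forest I) ↭ map (m *_) (openLabels h P ++ cVector m P)
  labels-forest nil = ↭-refl
  labels-forest (up {P} I) = ↭-trans (labels-forest I) (↭-reflexive (cong (map (m *_)) (sym (cVector-N P))))
  labels-forest (down {h} {P₁ = P₁} A B a b refl I J refl _) = ↭-trans
    (prep (m * cnt m h A) (++⁺ (labels-forest J) (labels-forest I)))
    (↭-trans (Bag.prove 3 (var 0F ⊕ (var 1F ⊕ var 2F)) (var 0F ⊕ (var 2F ⊕ var 1F))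
      ([ m * cnt m h A ] ∷ᵥ map (m *_) (cVector m P₁) ∷ᵥ map (m *_) (openLabels h (A ++ B) ++ cVector m (A ++ B)) ∷ᵥ []ᵥ))
    (↭-reflexive (trans
      (cong (m * cnt m h A ∷_) (sym (map-++ (m *_) (openLabels h (A ++ B) ++ cVector m (A ++ B)) (cVector m P₁))))
      (cong (map (m *_)) (cong₂ _∷_ (sym (cnt-++E (B ++ P₁) a)) eq)))))
    where
    open ≡-Reasoning
    eq : (openLabels h (A ++ B) ++ cVector m (A ++ B)) ++ cVector m P₁
       ≡ openLabels h (A ++ E ∷ B ++ P₁) ++ cVector m (A ++ E ∷ B ++ P₁)
    eq = begin
      (openLabels h (A ++ B) ++ cVector m (A ++ B)) ++ cVector m P₁
        ≡⟨ ++-assoc (openLabels h (A ++ B)) (cVector m (A ++ B)) (cVector m P₁) ⟩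
      openLabels h (A ++ B) ++ cVector m (A ++ B) ++ cVector m P₁
        ≡⟨ cong₂ _++_
             (trans (openLabels-prefix B h ≤-refl a) (sym (openLabels-prefix (E ∷ B ++ P₁) h ≤-refl a)))
             (begin
               cVector m (A ++ B) ++ cVector m P₁            ≡⟨ cong (_++ cVector m P₁) (cVector-++ B a) ⟩
               (cVector m A ++ cVector m B) ++ cVector m P₁  ≡⟨ ++-assoc (cVector m A) (cVector m B) (cVector m P₁) ⟩
               cVector m A ++ cVector m B ++ cVector m P₁    ≡⟨ cong (cVector m A ++_) (cVector-++ P₁ b) ⟨
               cVector m A ++ cVector m (B ++ P₁)            ≡⟨ cVector-++ (E ∷ B ++ P₁) a ⟨
               cVector m (A ++ E ∷ B ++ P₁)                  ∎) ⟩
      openLabels h (A ++ E ∷ B ++ P₁) ++ cVector m (A ++ E ∷ B ++ P₁) ∎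

  arities-forest : ∀ {h P Q} (I : Interval h P Q) → arities (forest I) ↭ map (m *_) (risesAfter m Q)
  arities-forest nil = ↭-refl
  arities-forest (up I) = arities-forest I
  arities-forest (down {Q₀ = Q₀} {Q₁ = Q₁} A B a b refl I J _ refl) = ↭-trans
    (++⁺ (↭-reflexive (cong [_] (roots-forest J))) (++⁺ (arities-forest J) (arities-forest I)))
    (↭-trans (Bag.prove 3 (var 0F ⊕ (var 1F ⊕ (var 2F))) (var 2F ⊕ (var 0F ⊕ var 1F))
      ([ m * mrises m Q₁ ] ∷ᵥ map (m *_) (risesAfter m Q₁) ∷ᵥ map (m *_) (risesAfter m Q₀) ∷ᵥ []ᵥ))
    (↭-reflexive (trans
      (sym (map-++ (m *_) (risesAfter m Q₀) (mrises m Q₁ ∷ risesAfter m Q₁)))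
      (cong (map (m *_)) (sym (risesAfter-++E m Q₀ Q₁))))))

  forest≢∅ : ∀ {h P Q} (I : Interval (suc h) P Q) → forest I ≡ ∅ → ⊥
  forest≢∅ (down _ _ _ _ _ _ _ _ _) ()

  -- By induction the subforests determine `P₁`, `Q₁`, `A ++ B` and `Q₀`; the label, divided by `m`,
  -- locates the cut between `A` and `B`.
  forest-injective : ∀ {h P Q P′ Q′} (I : Interval h P Q) (J : Interval h P′ Q′) → forest I ≡ forest J → P ≡ P′ × Q ≡ Q′
  forest-injective nil nil _ = refl , refl
  forest-injective nil (up J) e = ⊥-elim (forest≢∅ J (sym e))
  forest-injective (up I) nil e = ⊥-elim (forest≢∅ I e)
  forest-injective (up I) (up J) e with forest-injective I J e
  ... | refl , refl = refl , refl
  forest-injective (down A B a b refl I J refl refl) (down A′ B′ a′ b′ refl I′ J′ refl refl) e with node-injective e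
  ... | eJ , el , eI with forest-injective I I′ eI | forest-injective J J′ eJ
  ... | eP , refl | refl , refl with split-contact a a′ b b′ (*-cancelˡ-≡ _ _ m el) eP
  ... | refl , refl = refl , refl

  length-walk : ∀ {h P k} → Walk h P k → h + countN m P * suc m ≡ length P + k
  length-walk {h} done = +-identityʳ h
  length-walk {h} (north {P = P} w) = trans (eq h m (countN m P * suc m)) (cong suc (length-walk w))
    where
    eq : ∀ h m c → h + (suc m + c) ≡ suc (h + m + c)
    eq = solve-∀
  length-walk (east w) = cong suc (length-walk w)

  -- The first descents of the two paths fix `A`, `Q₀` and `Q₁`, so only the cut between `B` and
  -- `P₁` needs an argument.
  forest-unique : ∀ {h P Q} (I J : Interval h P Q) → forest I ≡ forest J
  forest-unique′ : ∀ {h P Q P′ Q′} (I : Interval h P Q) (J : Interval h P′ Q′) → P ≡ P′ → Q ≡ Q′ → forest I ≡ forest J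
  forest-unique I J = forest-unique′ I J refl refl
  forest-unique′ nil nil _ _ = refl
  forest-unique′ nil (up J) () _
  forest-unique′ (up I) nil () _
  forest-unique′ (up I) (up J) refl refl = forest-unique′ I J refl refl
  forest-unique′ (down {h} {P₁ = P₁} A B a b refl I J refl refl) (down {P₁ = P₁′} A′ B′ a′ b′ refl I′ J′ refl refl) eP eQ
    with split-++E a a′ eP | split-++E (upper-walk I) (upper-walk I′) eQ
  ... | refl , eP′ | refl , refl with append-unique B {A′ = B′} lenB eP′
    where
    open ≡-Reasoning
    -- `P₁` has as many vertical steps as `Q₁` and walks between the same heights, which fixes its
    -- length.
    lenP : length P₁ ≡ length P₁′
    lenP = +-cancelʳ-≡ 0 _ _ (trans (sym (length-walk (lower-walk J)))
           (trans (cong (_* suc m) (trans (same-size J) (sym (same-size J′)))) (length-walk (lower-walk J′))))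
    lenB : length B ≡ length B′
    lenB = +-cancelʳ-≡ (length P₁) _ _ (begin
      length B + length P₁    ≡⟨ length-++ B ⟨
      length (B ++ P₁)        ≡⟨ cong length eP′ ⟩
      length (B′ ++ P₁′)      ≡⟨ length-++ B′ ⟩
      length B′ + length P₁′  ≡⟨ cong (length B′ +_) lenP ⟨
      length B′ + length P₁   ∎)
  ... | refl , refl = cong₂ (λ x y → node x (m * cnt m h A) y) (forest-unique′ J J′ refl refl) (forest-unique′ I I′ refl refl)

  depth-unique : ∀ {h P Q} (I J : Interval h P Q) → depth I ≡ depth J
  depth-unique {h} {P} I J = *-cancelˡ-≡ _ _ m (+-cancelʳ-≡ (countN m P * tri m) _ _ (+-cancelʳ-≡ (tri h) _ _
    (trans (sym (slack-forest I)) (trans (cong slack (forest-unique I J)) (slack-forest J)))))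

  small-multiple : ∀ h x → h < m → m ∣ h + m * x → h ≡ 0
  small-multiple zero x _ _ = refl
  small-multiple (suc h) x h<m d = ⊥-elim (>⇒∤ h<m (∣m+n∣m⇒∣n (subst (m ∣_) (+-comm (suc h) (m * x)) d) (m∣m*n x)))

  quotient-≤ : ∀ q c h → h < m → q * m ≤ m * c + h → q ≤ c
  quotient-≤ q c h h<m le = ≮⇒≥ λ c<q → <-irrefl refl (begin-strict
    m * c + h   <⟨ +-monoʳ-< (m * c) h<m ⟩
    m * c + m   ≡⟨ trans (+-comm (m * c) m) (cong (m +_) (*-comm m c)) ⟩
    suc c * m   ≤⟨ *-monoˡ-≤ m c<q ⟩
    q * m       ≤⟨ le ⟩
    m * c + h   ∎)
    where open ≤-Reasoning

  -- Converse of `forest`, with the starting height normalised below `m`. A divisible arity forces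
  -- the interval of the children to start at height 0; a divisible label gives the number of
  -- contacts after which the lower path is cut.
  realise : ∀ {F} → Valid F → All (m ∣_) (labels F) → All (m ∣_) (arities F) →
    Σ[ h ∈ ℕ ] h < m × ∃₂ λ P Q → Σ[ I ∈ Interval h P Q ] forest I ≡ F
  realise ∅ _ _ = 0 , s≤s z≤n , [] , [] , nil , refl
  realise {node C l D} (node vC l≤ vD) (divides q refl ∷ dl) (dr ∷ da)
    with realise vC (All.++⁻ˡ (labels C) dl) (All.++⁻ˡ (arities C) da)
       | realise vD (All.++⁻ʳ (labels C) dl) (All.++⁻ʳ (arities C) da)
  ... | h₁ , h₁< , P₁ , Q₁ , J , refl | h , h< , P₀ , Q₀ , I , refl
    with small-multiple h₁ (mrises m Q₁) h₁< (subst (m ∣_) (roots-forest J) dr)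
  ... | refl
    with contact-split q (lower-walk I) (quotient-≤ q _ h h< (subst (q * m ≤_) (contacts-forest I) l≤))
  ... | A , B , a , b , e , c = close (m≤n⇒m<n∨m≡n h<)
    where
    K : Interval (suc h) (A ++ E ∷ B ++ P₁) (Q₀ ++ E ∷ Q₁)
    K = down A B a b e I J refl refl
    K≡ : forest K ≡ node (forest J) (q * m) (forest I)
    K≡ = cong (λ l → node (forest J) l (forest I)) (trans (cong (m *_) c) (*-comm m q))
    -- At height `m` a vertical step is put in front, which returns the starting height to 0 without
    -- changing the forest.
    close : suc h < m ⊎ suc h ≡ m →
      Σ[ h ∈ ℕ ] h < m × ∃₂ λ P Q → Σ[ L ∈ Interval h P Q ] forest L ≡ node (forest J) (q * m) (forest I)
    close (inj₁ lt) = suc h , lt , _ , _ , K , K≡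
    close (inj₂ refl) = 0 , s≤s z≤n , _ , _ , up K , K≡

  -- Rotations

  -- After the first step the height is `suc m′`. Measured from height 1, the inner part `X` walks
  -- from `m′` to 0, so the last `E` is the first return to the base line.
  data Prim : Path → Set where
    prim : ∀ {X} → Walk m′ X 0 → Prim (N ∷ X ++ E ∷ [])

  prim-walk : ∀ {Z} → Prim Z → ∀ h → Walk h Z h
  prim-walk (prim w) zero = north (walk-++E w done)
  prim-walk p (suc h) = walk-shift (prim-walk p h)

  cnt-prim : ∀ {Z} → Prim Z → cnt m 0 Z ≡ 1
  cnt-prim (prim w) = cong suc (cnt-raised (E ∷ []) w)

  data Rot : Path → Path → Set where
    exchange  : ∀ {Z S} → Prim Z → Rot (E ∷ Z ++ S) (Z ++ E ∷ S)
    under : ∀ {s P P′} → Rot P P′ → Rot (s ∷ P) (s ∷ P′)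

  rot-++ˡ : ∀ A {P P′} → Rot P P′ → Rot (A ++ P) (A ++ P′)
  rot-++ˡ [] r = r
  rot-++ˡ (s ∷ A) r = under (rot-++ˡ A r)

  rot-++ʳ : ∀ {P P′} S → Rot P P′ → Rot (P ++ S) (P′ ++ S)
  rot-++ʳ T (exchange {Z} {S} z) rewrite ++-assoc Z S T | ++-assoc Z (E ∷ S) T = exchange z
  rot-++ʳ T (under r) = under (rot-++ʳ T r)

  rot-walk : ∀ {h P P′} → Rot P P′ → Walk h P 0 → Walk h P′ 0
  rot-walk (exchange z) (east w) = walk-++ (prim-walk z _) (east (walk-cancelˡ (prim-walk z _) w))
  rot-walk (under r) (north w) = north (rot-walk r w)
  rot-walk (under r) (east w) = east (rot-walk r w)

  -- A rotation lifts `Z` by one unit and leaves what precedes and follows in place, so contacts may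
  -- be lost but are never created.
  rot-cnt : ∀ {h P P′} → Rot P P′ → Walk h P 0 → cnt m h P′ ≤ cnt m h P
  rot-cnt {suc h} (exchange {Z} {S} z) (east w) rewrite cnt-raised (E ∷ S) (prim-walk z h) = le h
    where
    le : ∀ h → cnt m h S ≤ cnt m h (Z ++ S)
    le zero = subst (cnt m 0 S ≤_) (sym (cnt-++ S (prim-walk z 0))) (m≤n+m _ (cnt m 0 Z))
    le (suc h) = ≤-reflexive (sym (cnt-raised S (prim-walk z h)))
  rot-cnt (under r) (north {zero} w) = s≤s (rot-cnt r w)
  rot-cnt (under r) (north {suc h} w) = rot-cnt r w
  rot-cnt (under r) (east w) = rot-cnt r w

  -- `Z` cannot contain the displayed `E`, which would take it below height 0.
  alignE : ∀ {a b Z P Y T} → Walk a Z b → Walk a P 0 → P ++ E ∷ T ≡ Z ++ Y →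
    Σ[ R ∈ Path ] P ≡ Z ++ R × Y ≡ R ++ E ∷ T
  alignE {P = P} done _ e = P , refl , sym e
  alignE (north z) done ()
  alignE (north z) (north w) e with alignE z w (∷-injectiveʳ e)
  ... | R , refl , e′ = R , refl , e′
  alignE (north z) (east w) ()
  alignE (east z) (north w) ()
  alignE (east z) (east w) e with alignE z w (∷-injectiveʳ e)
  ... | R , refl , e′ = R , refl , e′

  -- Started at `suc a`, the walk along `Z` stays at height 1 or more, whereas `P` ends at height 0.
  align : ∀ {a b Z P Y T} → Walk a Z b → Walk (suc a) P 0 → P ++ T ≡ Z ++ Y →
    Σ[ R ∈ Path ] P ≡ Z ++ R × Y ≡ R ++ T
  align {P = P} done _ e = P , refl , sym e
  align (north z) (north w) e with align z w (∷-injectiveʳ e)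
  ... | R , refl , e′ = R , refl , e′
  align (north z) (east w) ()
  align (east z) (north w) ()
  align (east z) (east w) e with align z w (∷-injectiveʳ e)
  ... | R , refl , e′ = R , refl , e′

  -- The possible positions, relative to the distinguished E of A E B, of the
  -- step E moved by a rotation from P to A E B.
  data SplitE (h : ℕ) (A B P : Path) : Set where
    before : ∀ A′ → P ≡ A′ ++ E ∷ B → Rot A′ A → Walk h A′ 0 → SplitE h A B P
    across : ∀ C Z → Prim Z → Walk h C 0 → A ≡ C ++ Z → P ≡ C ++ E ∷ Z ++ B → SplitE h A B P
    after  : ∀ B′ → P ≡ A ++ E ∷ B′ → Rot B′ B → SplitE h A B P

  splitE-N : ∀ {h A B P} → SplitE (h + m) A B P → SplitE h (N ∷ A) B (N ∷ P)
  splitE-N (before A′ e r w) = before (N ∷ A′) (cong (N ∷_) e) (under r) (north w)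
  splitE-N (across C Z z w e f) = across (N ∷ C) Z z (north w) (cong (N ∷_) e) (cong (N ∷_) f)
  splitE-N (after B′ e r) = after B′ (cong (N ∷_) e) r

  splitE-E : ∀ {h A B P} → SplitE h A B P → SplitE (suc h) (E ∷ A) B (E ∷ P)
  splitE-E (before A′ e r w) = before (E ∷ A′) (cong (E ∷_) e) (under r) (east w)
  splitE-E (across C Z z w e f) = across (E ∷ C) Z z (east w) (cong (E ∷_) e) (cong (E ∷_) f)
  splitE-E (after B′ e r) = after B′ (cong (E ∷_) e) r

  rot-splitE : ∀ {h A B P P′} → Rot P P′ → P′ ≡ A ++ E ∷ B → Walk h A 0 → SplitE h A B P
  rot-splitE {h} (exchange {Z} z) e a with alignE (prim-walk z h) a (sym e)
  ... | [] , refl , refl with walk-cancelˡ (prim-walk z h) a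
  ... | done = across [] Z z done (++-identityʳ Z) refl
  rot-splitE {h} (exchange {Z} z) e a | E ∷ R , refl , refl with walk-cancelˡ (prim-walk z h) a
  ... | east r = before (E ∷ Z ++ R) (cong (E ∷_) (sym (++-assoc Z R _))) (exchange z) (east (walk-++ (prim-walk z _) r))
  rot-splitE (under {P = P} r) refl done = after P refl r
  rot-splitE (under r) refl (north a) = splitE-N (rot-splitE r refl a)
  rot-splitE (under r) refl (east a) = splitE-E (rot-splitE r refl a)

  data Split (h : ℕ) (A B P : Path) : Set where
    left  : ∀ A′ → P ≡ A′ ++ B → Rot A′ A → Walk h A′ 0 → Split h A B P
    right : ∀ B′ → P ≡ A ++ B′ → Rot B′ B → Split h A B P

  -- Unlike for `SplitE`, nothing straddles the cut: after the rotation the moved primitive path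
  -- runs at height 1 or more, whereas the cut is at height 0.
  rot-split : ∀ {h A B P P′} → Rot P P′ → P′ ≡ A ++ B → Walk h A 0 → Walk h P 0 → Split h A B P
  rot-split {suc h} (exchange {Z} z) e a (east p) with align (prim-walk z h) a (sym e)
  ... | R , refl , e′ with walk-cancelˡ (prim-walk z (suc h)) a
  rot-split {suc h} (exchange {Z} z) e a (east p) | E ∷ R , refl , refl | east r =
    left (E ∷ Z ++ R) (cong (E ∷_) (sym (++-assoc Z R _))) (exchange z) (east (walk-++ (prim-walk z h) r))
  rot-split (under r) refl done p = right _ refl (under r)
  rot-split (under r) refl (north a) (north p) with rot-split r refl a p
  ... | left A′ e r′ w = left (N ∷ A′) (cong (N ∷_) e) (under r′) (north w)
  ... | right B′ e r′ = right B′ (cong (N ∷_) e) r′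
  rot-split (under r) refl (east a) (east p) with rot-split r refl a p
  ... | left A′ e r′ w = left (E ∷ A′) (cong (E ∷_) e) (under r′) (east w)
  ... | right B′ e r′ = right B′ (cong (E ∷_) e) r′

  rot-nonempty : ∀ {P P′} → Rot P P′ → P′ ≡ [] → ⊥
  rot-nonempty (exchange (prim _)) ()
  rot-nonempty (under _) ()

  rot-N : ∀ {P P′ X} → Rot P P′ → P′ ≡ N ∷ X → Walk 0 P 0 → Σ[ Y ∈ Path ] P ≡ N ∷ Y × Rot Y X
  rot-N (under r) refl w = _ , refl , r

  -- Undoing a rotation of the distinguished `E` shifts one primitive path from `A` to `B`, adding
  -- one contact. Any other rotation is undone inside `A ++ B` or `P₁`, where induction applies, and
  -- the contacts of `B` do not decrease.
  rot-int : ∀ {h P P′ Q} → Rot P P′ → Walk h P 0 → (I : Interval h P′ Q) → Σ[ J ∈ Interval h P Q ] depth I < depth J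
  rot-int r w nil = ⊥-elim (rot-nonempty r refl)
  rot-int r w (up I) with rot-N r refl w
  rot-int r (north w) (up I) | Y , refl , r′ with rot-int r′ w I
  ... | J , lt = up J , lt
  rot-int {suc h} r w (down {P₁ = P₁} A B a b refl I J e eQ) with rot-splitE r e a
  ... | before A′ refl r′ a′ with rot-int (rot-++ʳ B r′) (walk-++ a′ b) I
  ... | I′ , lt = down A′ B a′ b refl I′ J refl eQ , +-monoˡ-< (cnt m 0 B) (+-monoˡ-< (depth J) lt)
  rot-int {suc h} r w (down {P₁ = P₁} A B a b refl I J e eQ) | across C Z z c refl refl =
    down C (Z ++ B) c (walk-++ (prim-walk z 0) b) (++-assoc C Z B) I J (cong (λ X → C ++ E ∷ X) (sym (++-assoc Z B P₁))) eQ ,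
    ≤-reflexive (trans (sym (+-suc (depth I + depth J) (cnt m 0 B)))
      (cong (depth I + depth J +_) (sym (trans (cnt-++ B (prim-walk z 0)) (cong (_+ cnt m 0 B) (cnt-prim z))))))
  rot-int {suc h} r w (down {P₁ = P₁} A B a b refl I J e eQ) | after R refl r′
    with walk-cancelˡ (walk-shift a) w
  ... | east v with rot-split r′ refl b v
  ... | left B′ refl r″ b′ with rot-int (rot-++ˡ A r″) (walk-++ a b′) I
  ... | I′ , lt = down A B′ a b′ refl I′ J refl eQ , +-mono-<-≤ (+-monoˡ-< (depth J) lt) (rot-cnt r″ b′)
  rot-int {suc h} r w (down {P₁ = P₁} A B a b refl I J e eQ) | after R refl r′ | east v | right P₁′ refl r″
    with rot-int r″ (walk-cancelˡ b v) J
  ... | J′ , lt = down A B a b refl I J′ refl eQ , +-monoˡ-< (cnt m 0 B) (+-monoʳ-< (depth I) lt)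

  descend : ∀ {a P} g h → a ≡ suc (g + h) → Walk a P 0 →
    ∃₂ λ X S → P ≡ X ++ E ∷ S × Walk g X 0 × Walk h S 0
  descend g h e (north w) with descend (g + m) h (trans (cong (_+ m) e) (eq g h m)) w
    where
    eq : ∀ g h m → suc (g + h) + m ≡ suc (g + m + h)
    eq = solve-∀
  ... | X , S , refl , x , s = N ∷ X , S , refl , north x , s
  descend zero h refl (east w) = [] , _ , refl , done , w
  descend (suc g) h refl (east w) with descend g h refl w
  ... | X , S , refl , x , s = E ∷ X , S , refl , east x , s

  prim-split : ∀ {B} → Walk 0 (N ∷ B) 0 → ∃₂ λ Z S → N ∷ B ≡ Z ++ S × Prim Z × Walk 0 S 0
  prim-split (north w) with descend m′ 0 (cong suc (sym (+-identityʳ m′))) w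
  ... | X , S , refl , x , s = N ∷ X ++ E ∷ [] , S , cong (N ∷_) (sym (++-assoc X (E ∷ []) S)) , prim x , s

  -- A partial converse of `rot-int`. `B` is emptied first, one primitive path at a time; once it is
  -- empty, `A` is the whole lower path of `I`, and a rotation of `A` or `P₁` is a rotation of `P`.
  step : ∀ {h P Q} (I : Interval h P Q) →
    (depth I ≡ 0 × P ≡ Q) ⊎ (Σ[ P′ ∈ Path ] Rot P P′ × Σ[ J ∈ Interval h P′ Q ] depth I ≡ suc (depth J))
  step nil = inj₁ (refl , refl)
  step (up I) with step I
  ... | inj₁ (e , refl) = inj₁ (e , refl)
  ... | inj₂ (P′ , r , J , e) = inj₂ (N ∷ P′ , under r , up J , e)
  step (down {P₁ = P₁} A [] a b refl I J refl refl) with step I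
  ... | inj₂ (P′ , r , I′ , e) = inj₂ (P′ ++ E ∷ P₁ ,
    subst (λ X → Rot (X ++ E ∷ P₁) (P′ ++ E ∷ P₁)) (++-identityʳ A) (rot-++ʳ (E ∷ P₁) r) ,
    down P′ [] (lower-walk I′) done (sym (++-identityʳ P′)) I′ J refl refl ,
    cong (λ d → d + depth J + 0) e)
  ... | inj₁ (e , refl) with step J
  ... | inj₁ (e′ , refl) = inj₁ (cong₂ (λ d d′ → d + d′ + 0) e e′ , cong (_++ E ∷ P₁) (sym (++-identityʳ A)))
  ... | inj₂ (P′ , r , J′ , e′) = inj₂ (A ++ E ∷ P′ , rot-++ˡ A (under r) ,
    down A [] a done refl I J′ refl refl ,
    trans (cong₂ (λ d d′ → d + d′ + 0) e e′) (cong (λ d → suc (d + depth J′ + 0)) (sym e)))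
  step (down {P₁ = P₁} A (N ∷ B) a b refl I J refl refl) with prim-split b
  ... | Z , S , eB , z , s = inj₂ ((A ++ Z) ++ E ∷ S ++ P₁ ,
    subst (λ X → Rot (A ++ E ∷ X ++ P₁) ((A ++ Z) ++ E ∷ S ++ P₁)) (sym eB) rot ,
    down (A ++ Z) S (walk-++ a (prim-walk z 0)) s (trans (cong (A ++_) eB) (sym (++-assoc A Z S))) I J refl refl ,
    trans (cong (depth I + depth J +_) (trans (cong (cnt m 0) eB)
      (trans (cnt-++ S (prim-walk z 0)) (cong (_+ cnt m 0 S) (cnt-prim z))))) (+-suc (depth I + depth J) (cnt m 0 S)))
    where
    rot : Rot (A ++ E ∷ (Z ++ S) ++ P₁) ((A ++ Z) ++ E ∷ S ++ P₁)
    rot rewrite ++-assoc Z S P₁ | ++-assoc A Z (E ∷ S ++ P₁) = rot-++ˡ A (exchange z)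

  -- Every descent is decomposed with `B` empty. The bound on the length carries the recursion, as
  -- the pieces of a first descent are not structurally smaller.
  int-refl : ∀ {h P} → Walk h P 0 → Σ[ I ∈ Interval h P P ] depth I ≡ 0
  int-refl w = go _ ≤-refl w
    where
    go : ∀ {h P} n → length P ≤ n → Walk h P 0 → Σ[ I ∈ Interval h P P ] depth I ≡ 0
    go n le done = nil , refl
    go {zero} (suc n) (s≤s le) (north w) with go n le w
    ... | I , e = up I , e
    go {suc h} {P} (suc n) le w with descend h 0 (cong suc (sym (+-identityʳ h))) w
    ... | X , S , refl , x , s with go n (≤-trans lX len) x | go n (≤-trans lS len) s
      where
      len : length X + length S ≤ n
      len = ≤-pred (subst (_≤ suc n) (trans (length-++ X) (+-suc (length X) (length S))) le)
      lX : length X ≤ length X + length S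
      lX = m≤m+n _ _
      lS : length S ≤ length X + length S
      lS = m≤n+m _ _
    ... | I , e | J , e′ = down X [] x done (sym (++-identityʳ X)) I J refl refl , cong₂ (λ d d′ → d + d′ + 0) e e′

  -- The order and the distance

  aboveFrom⇒walk : ∀ h P → T (aboveFrom m h P) → Walk h P 0
  aboveFrom⇒walk zero [] _ = done
  aboveFrom⇒walk h (N ∷ P) t = north (aboveFrom⇒walk (h + m) P t)
  aboveFrom⇒walk (suc h) (E ∷ P) t = east (aboveFrom⇒walk h P t)

  walk⇒aboveFrom : ∀ {h P} → Walk h P 0 → T (aboveFrom m h P)
  walk⇒aboveFrom done = tt
  walk⇒aboveFrom (north {zero} w) = walk⇒aboveFrom w
  walk⇒aboveFrom (north {suc h} w) = walk⇒aboveFrom w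
  walk⇒aboveFrom (east w) = walk⇒aboveFrom w

  ballots⁻ : ∀ n {P} → P ∈ ballots m n → countN m P ≡ n × Walk 0 P 0
  ballots⁻ n {P} p with to (T-∧ {countN m P ≡ᵇ n}) (proj₂ (∈-filter⁻ (T? ∘ isBallot m n) {xs = allPaths m (n * suc m)} p))
  ... | c , a = ≡ᵇ⇒≡ _ _ c , aboveFrom⇒walk 0 P a

  ballots⁺ : ∀ {n P} → countN m P ≡ n → Walk 0 P 0 → P ∈ ballots m n
  ballots⁺ {n} {P} refl w = ∈-filter⁺ (T? ∘ isBallot m n)
    (subst (λ k → P ∈ allPaths m k) (sym (trans (length-walk w) (+-identityʳ _))) (∈-allPaths m P))
    (from T-∧ (≡⇒≡ᵇ (countN m P) _ refl , walk⇒aboveFrom w))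

  primGo-walk : ∀ {h X} S → Walk h X 0 → primGo m (suc h) (X ++ E ∷ S) ≡ (X ++ E ∷ [] , S)
  primGo-walk S done = refl
  primGo-walk S (north w) rewrite primGo-walk S w = refl
  primGo-walk S (east w) rewrite primGo-walk S w = refl

  rotations⁻ : ∀ {h P P′} → Walk h P 0 → P′ ∈ rotations m P → Rot P P′
  rotations⁻ {P = []} w ()
  rotations⁻ {P = N ∷ P} (north w) p with ∈-map⁻ (N ∷_) p
  ... | _ , q , refl = under (rotations⁻ w q)
  rotations⁻ {P = E ∷ []} (east w) ()
  rotations⁻ {P = E ∷ E ∷ P} (east w) p with ∈-map⁻ (E ∷_) p
  ... | _ , q , refl = under (rotations⁻ w q)
  rotations⁻ {P = E ∷ N ∷ P} (east w) (there p) with ∈-map⁻ (E ∷_) p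
  ... | _ , q , refl = under (rotations⁻ w q)
  rotations⁻ {P = E ∷ N ∷ P} (east {h} (north w)) (here refl)
    with descend m′ h (trans (+-suc h m′) (cong suc (+-comm h m′))) w
  ... | X , S , refl , x , s rewrite primGo-walk S x =
    subst (λ Y → Rot Y (N ∷ (X ++ E ∷ []) ++ E ∷ S)) (cong (λ Y → E ∷ N ∷ Y) (++-assoc X (E ∷ []) S)) (exchange (prim x))

  rotations⁺ : ∀ {P P′} → Rot P P′ → P′ ∈ rotations m P
  rotations⁺ (exchange {S = S} (prim {X} x)) rewrite ++-assoc X (E ∷ []) S | primGo-walk S x = here refl
  rotations⁺ (under {N} r) = ∈-map⁺ (N ∷_) (rotations⁺ r)
  rotations⁺ (under {E} {P = []} ())
  rotations⁺ (under {E} {P = E ∷ P} r) = ∈-map⁺ (E ∷_) (rotations⁺ r)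
  rotations⁺ (under {E} {P = N ∷ P} r) = there (∈-map⁺ (E ∷_) (rotations⁺ r))

  -- Each rotation on the way from `P` to `Q` is absorbed by `rot-int`, so the depth below a fixed
  -- upper path is a strict rank for the order.
  reach-int : ∀ k {P Q R} → Walk 0 P 0 → Q ∈ reach m k P → (J : Interval 0 Q R) →
    P ≡ Q ⊎ Σ[ I ∈ Interval 0 P R ] depth J < depth I
  reach-int zero w (here refl) J = inj₁ refl
  reach-int (suc k) w (here refl) J = inj₁ refl
  reach-int (suc k) {P} w (there q) J with find (∈-concatMap⁻ (reach m k) {xs = rotations m P} q)
  ... | P′ , p , q′ with rotations⁻ w p
  ... | r with reach-int k (rot-walk r w) q′ J
  ... | inj₁ refl = inj₂ (rot-int r w J)
  ... | inj₂ (I , lt) with rot-int r w I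
  ... | I′ , lt′ = inj₂ (I′ , <-trans lt lt′)

  reach-walk : ∀ k {P Q} → Walk 0 P 0 → Q ∈ reach m k P → Walk 0 Q 0
  reach-walk zero w (here refl) = w
  reach-walk (suc k) w (here refl) = w
  reach-walk (suc k) {P} w (there q) with find (∈-concatMap⁻ (reach m k) {xs = rotations m P} q)
  ... | P′ , p , q′ = reach-walk k (rot-walk (rotations⁻ w p) w) q′

  reach⇒int : ∀ k {P Q} → Walk 0 P 0 → Q ∈ reach m k P → Interval 0 P Q
  reach⇒int k w q with int-refl (reach-walk k w q)
  ... | J , _ with reach-int k w q J
  ... | inj₁ refl = J
  ... | inj₂ (I , _) = I

  int⇒reach : ∀ k {P Q} (I : Interval 0 P Q) → depth I ≤ k → Q ∈ reach m k P
  int⇒reach k I le with step I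
  int⇒reach zero I le | inj₁ (_ , refl) = here refl
  int⇒reach (suc k) I le | inj₁ (_ , refl) = here refl
  int⇒reach zero I le | inj₂ (P′ , r , J , e) = ⊥-elim (n≮0 (subst (_≤ 0) e le))
  int⇒reach (suc k) I le | inj₂ (P′ , r , J , e) =
    there (∈-concatMap⁺ (reach m k) (lose (rotations⁺ r) (int⇒reach k J (≤-pred (subst (_≤ suc k) e le)))))

  -- Iterating `step` gives lower ends of decreasing depth, which are distinct by `depth-unique`.
  -- Their number bounds the depth by the number of ballot paths, that is, by the fuel.
  chain : ∀ d {P Q} (I : Interval 0 P Q) → depth I ≡ d →
    ∃ λ xs → length xs ≡ suc d × Unique xs × (∀ {X} → X ∈ xs → Σ[ J ∈ Interval 0 X Q ] depth J ≤ d)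
  chain d {P} I e with step I
  chain zero {P} I e | inj₁ _ = P ∷ [] , refl , [] ∷ [] , λ { (here refl) → I , ≤-reflexive e }
  chain (suc d) I e | inj₁ (e′ , _) = ⊥-elim (0≢1+n (trans (sym e′) e))
  chain zero I e | inj₂ (_ , _ , _ , e′) = ⊥-elim (0≢1+n (trans (sym e) e′))
  chain (suc d) {P} I e | inj₂ (P′ , r , J , e′) with chain d J (suc-injective (trans (sym e′) e))
  ... | xs , l , u , f = P ∷ xs , cong suc l , All.tabulate fresh ∷ u , f′
    where
    fresh : ∀ {X} → X ∈ xs → P ≢ X
    fresh p refl with f p
    ... | K , le = 1+n≰n (≤-trans (≤-reflexive (trans (sym e) (depth-unique I K))) le)
    f′ : ∀ {X} → X ∈ P ∷ xs → Σ[ J ∈ Interval 0 X _ ] depth J ≤ suc d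
    f′ (here refl) = I , ≤-reflexive e
    f′ (there p) with f p
    ... | K , le = K , m≤n⇒m≤1+n le

  module _ (n : ℕ) where

    int-ballots : ∀ {P Q} → Interval 0 P Q → countN m Q ≡ n → P ∈ ballots m n
    int-ballots I c = ballots⁺ (trans (same-size I) c) (lower-walk I)

    depth≤fuel : ∀ {P Q} (I : Interval 0 P Q) → countN m Q ≡ n → depth I ≤ fuel m n
    depth≤fuel {Q = Q} I c with chain (depth I) I refl
    ... | xs , l , u , f = <⇒≤ (subst (_≤ fuel m n) l (unique-length-≤ u (λ p → int-ballots (proj₁ (f p)) c)))

    leq⁺ : ∀ {P Q} → Interval 0 P Q → countN m Q ≡ n → T (leq m n P Q)
    leq⁺ I c = ∈ᵇ⁺ (int⇒reach (fuel m n) I (depth≤fuel I c))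

    leq⁻ : ∀ {P Q} → Walk 0 P 0 → T (leq m n P Q) → Interval 0 P Q
    leq⁻ w t = reach⇒int (fuel m n) w (∈ᵇ⁻ _ _ t)

    lt-depth : ∀ {P Q R} → Walk 0 P 0 → T (lt m n P Q) → (J : Interval 0 Q R) → (I : Interval 0 P R) → depth J < depth I
    lt-depth {P} {Q} w t J I with to (T-∧ {leq m n P Q}) t
    ... | q , ne with reach-int (fuel m n) w (∈ᵇ⁻ _ _ q) J
    ... | inj₁ refl = ⊥-elim (T-not⁻ ne (==ₚ-refl P))
    ... | inj₂ (I′ , l) = subst (depth J <_) (depth-unique I′ I) l

    -- Every rotation decreases the depth, so there is no room between P and P′
    -- when it drops by exactly one.
    rot-covers : ∀ {P P′ Q} → Rot P P′ → (I : Interval 0 P Q) (J : Interval 0 P′ Q) → countN m Q ≡ n →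
      depth I ≡ suc (depth J) → T (covers m n P P′)
    rot-covers {P} {P′} r I J c e = from T-∧ (from T-∧ (leq⁺ K cP′ , T-not⁺ ne) , T-not⁺ none)
      where
      cP′ : countN m P′ ≡ n
      cP′ = trans (same-size J) c
      K : Interval 0 P P′
      K = proj₁ (rot-int r (lower-walk I) (proj₁ (int-refl (lower-walk J))))
      ne : ¬ T (P ==ₚ P′)
      ne t with ==ₚ⇒≡ P P′ t
      ... | refl = 1+n≢n (trans (sym e) (depth-unique I J))
      none : ¬ T (any (λ C → lt m n P C ∧ lt m n C P′) (ballots m n))
      none t with find (Any.any⁻ _ (ballots m n) t)
      ... | C , C∈ , t′ with to (T-∧ {lt m n P C}) t′ | proj₂ (ballots⁻ n C∈)
      ... | t₁ , t₂ | wC with reach-int (fuel m n) wC (∈ᵇ⁻ _ _ (proj₁ (to (T-∧ {leq m n C P′}) t₂))) J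
      ... | inj₁ refl = T-not⁻ (proj₂ (to (T-∧ {leq m n C P′}) t₂)) (==ₚ-refl C)
      ... | inj₂ (L , l) = <-irrefl refl (≤-trans (s≤s l) (≤-trans (lt-depth (lower-walk I) t₁ L I) (≤-reflexive e)))

    -- Every strict relation lowers the depth by at least one, so no chain is longer; `step`
    -- provides covers lowering it by exactly one, so the bound is attained.
    longest≡depth : ∀ k {P Q} (I : Interval 0 P Q) → countN m Q ≡ n → depth I ≤ k → longest m n k P Q ≡ depth I
    longest≡depth zero I c le = sym (n≤0⇒n≡0 le)
    longest≡depth (suc k) {P} {Q} I c le with P ==ₚ Q in eq
    ... | true with ==ₚ⇒≡ P Q (from T-≡ eq)
    ... | refl with int-refl (lower-walk I)
    ... | J , e = trans (sym e) (depth-unique J I)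
    longest≡depth (suc k) {P} {Q} I c le | false = ≤-antisym (foldr-⊔-≤ _ upper) lower
      where
      candidates : List Path
      candidates = filterᵇ (λ C → covers m n P C ∧ leq m n C Q) (ballots m n)
      upper : ∀ {x} → x ∈ map (λ C → suc (longest m n k C Q)) candidates → x ≤ depth I
      upper p with ∈-map⁻ (λ C → suc (longest m n k C Q)) p
      ... | C , C∈ , refl with ∈-filter⁻ (λ C → T? (covers m n P C ∧ leq m n C Q)) {xs = ballots m n} C∈
      ... | C∈′ , t with to (T-∧ {covers m n P C}) t
      ... | t₁ , t₂ = subst (λ d → suc d ≤ depth I) (sym (longest≡depth k J c (≤-pred (≤-trans lt′ le)))) lt′
        where
        J = leq⁻ (proj₂ (ballots⁻ n C∈′)) t₂
        lt′ : depth J < depth I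
        lt′ = lt-depth (lower-walk I) (proj₁ (to (T-∧ {lt m n P C}) t₁)) J I
      lower : depth I ≤ foldr _⊔_ 0 (map (λ C → suc (longest m n k C Q)) candidates)
      lower with step I
      ... | inj₁ (e , _) = subst (_≤ _) (sym e) z≤n
      ... | inj₂ (C , r , J , e) = ≤-trans
        (≤-reflexive (trans e (cong suc (sym (longest≡depth k J c (≤-pred (subst (_≤ suc k) e le)))))))
        (≤-foldr-⊔ (∈-map⁺ (λ C → suc (longest m n k C Q))
          (∈-filter⁺ (λ C → T? (covers m n P C ∧ leq m n C Q)) (int-ballots J c)
            (from T-∧ (rot-covers r I J c e , leq⁺ J c)))))

    dist≡depth : ∀ {P Q} (I : Interval 0 P Q) → countN m Q ≡ n → dist m n P Q ≡ depth I
    dist≡depth I c = longest≡depth (fuel m n) I c (depth≤fuel I c)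

    intervals⁻ : ∀ {P Q} → (P , Q) ∈ intervals m n → Interval 0 P Q × countN m Q ≡ n
    intervals⁻ p with ∈-filter⁻ (λ I → T? (leq m n (proj₁ I) (proj₂ I))) {xs = cartesianProduct (ballots m n) (ballots m n)} p
    ... | p′ , t with ∈-cartesianProduct⁻ (ballots m n) (ballots m n) p′
    ... | P∈ , Q∈ = leq⁻ (proj₂ (ballots⁻ n P∈)) t , proj₁ (ballots⁻ n Q∈)

    intervals⁺ : ∀ {P Q} → Interval 0 P Q → countN m Q ≡ n → (P , Q) ∈ intervals m n
    intervals⁺ {Q = Q} I c = ∈-filter⁺ (λ I → T? (leq m n (proj₁ I) (proj₂ I)))
      (∈-cartesianProduct⁺ (int-ballots I c) (ballots⁺ c (upper-walk I))) (leq⁺ I c)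

  unique-intervals : ∀ n → Unique (intervals m n)
  unique-intervals n = Unique.filter⁺ (λ I → T? (leq m n (proj₁ I) (proj₂ I)))
    (Unique.cartesianProduct⁺ (unique-ballots m n) (unique-ballots m n))

  -- The last entry counts contacts with the line through the end of the last vertical step, where
  -- no vertical step follows.
  cVector-end : ∀ P → EndsInZero (cVector m P)
  cVector-end [] = inj₁ refl
  cVector-end (E ∷ P) = cVector-end P
  cVector-end (N ∷ P) with cVector-end P
  ... | inj₂ e = inj₂ (subst (λ xs → ∃ λ zs → xs ≡ zs ++ 0 ∷ []) (sym (cVector-N P)) (prepend-EndsInZero (openLabels m P) e))
  ... | inj₁ e = inj₂ (subst (λ xs → ∃ λ zs → xs ≡ zs ++ 0 ∷ [])
      (sym (trans (cVector-N P) (trans (cong (openLabels m P ++_) e) (++-identityʳ (openLabels m P))))) (last m′))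
    where
    cnt≡0 : ∀ P → cVector m P ≡ [] → cnt m 0 P ≡ 0
    cnt≡0 [] _ = refl
    cnt≡0 (E ∷ P) _ = refl
    cnt≡0 (N ∷ P) ()
    last : ∀ h → ∃ λ zs → openLabels (suc h) P ≡ zs ++ 0 ∷ []
    last zero = [] , cong (_∷ []) (cnt≡0 P e)
    last (suc h) = prepend-EndsInZero (cnt m (suc h) P ∷ []) (last h)

  -- A walk to height 0 without horizontal steps is empty, so nothing follows the last horizontal
  -- step.
  risesAfter-end : ∀ {h Q} → Walk h Q 0 → EndsInZero (risesAfter m Q)
  risesAfter-end done = inj₁ refl
  risesAfter-end (north w) = risesAfter-end w
  risesAfter-end (east {P = P} w) with risesAfter-end w
  ... | inj₂ e = inj₂ (prepend-EndsInZero (mrises m P ∷ []) e)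
  ... | inj₁ e = inj₂ ([] , cong₂ _∷_ (cong (mrises m) (proj₂ (empty w e))) e)
    where
    empty : ∀ {h Q} → Walk h Q 0 → risesAfter m Q ≡ [] → h ≡ 0 × Q ≡ []
    empty done _ = refl , refl
    empty (north {h} w) e = ⊥-elim (m+1+n≢0 h (proj₁ (empty w e)))
    empty (east w) ()

  -- The mirror on intervals

  ↭-multiples : ∀ {xs ys} → xs ↭ map (m *_) ys → All (m ∣_) xs
  ↭-multiples {ys = ys} p = All-resp-↭ (↭-sym p) (All.map⁺ (All.tabulate (λ {y} _ → m∣m*n y)))

  Mirrors : Path × Path → Path × Path → Set
  Mirrors (P , Q) (P′ , Q′) = Σ[ I ∈ Interval 0 P Q ] Σ[ J ∈ Interval 0 P′ Q′ ] forest J ≡ mirror (forest I)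

  mirrors-injective : ∀ {X X′ Y} → Mirrors X Y → Mirrors X′ Y → X ≡ X′
  mirrors-injective (I , J , e) (I′ , J′ , e′)
    with forest-injective I I′ (mirror-injective (valid-forest I) (valid-forest I′)
           (trans (sym e) (trans (forest-unique J J′) e′)))
  ... | refl , refl = refl

  -- Mirroring exchanges labels and arities, so both remain multiples of `m` and `realise` applies.
  -- The starting height is 0 because the roots of the mirror number `m * cnt m 0 P`.
  mirror-interval : ∀ {P Q} → Interval 0 P Q → ∃ (Mirrors (P , Q))
  mirror-interval {P} I
    with realise (Mirrored.valid M)
           (↭-multiples (↭-trans (Mirrored.labels↭ M) (arities-forest I)))
           (↭-multiples (↭-trans (Mirrored.arities↭ M) (labels-forest I)))
    where M = mirrored (valid-forest I)
  ... | h , h< , P′ , Q′ , J , e with small-multiple h (mrises m Q′) h<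
          (subst (m ∣_) (trans (sym roots≡contacts) (roots-forest J)) (m∣m*n (cnt m 0 P)))
    where
    roots≡contacts : roots (forest J) ≡ m * cnt m 0 P
    roots≡contacts = trans (cong roots e) (trans (Mirrored.roots≡ (mirrored (valid-forest I)))
      (trans (contacts-forest I) (+-identityʳ _)))
  ... | refl = (P′ , Q′) , I , J , e

  mirrors-size : ∀ {P Q P′ Q′} → Mirrors (P , Q) (P′ , Q′) → countN m P′ ≡ countN m P
  mirrors-size (I , J , e) = *-cancelˡ-≡ _ _ m (trans (sym (size-forest J))
    (trans (cong size e) (trans (Mirrored.size≡ (mirrored (valid-forest I))) (size-forest I))))

  mirrors-monomial : ∀ n {P Q P′ Q′} → countN m Q ≡ n → Mirrors (P , Q) (P′ , Q′) →
    intervalMonomial m n (P′ , Q′) ≡ swapXY (intervalMonomial m n (P , Q))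
  mirrors-monomial n {P} {Q} {P′} {Q′} c R@(I , J , e) = mono-cong c′ r′ (sortℕ-↭ cv) (sortℕ-↭ rv) d
    where
    M = mirrored (valid-forest I)
    c′ : mcontacts m P′ ≡ mrises m Q
    c′ = trans (contactsFrom≡cnt (lower-walk J)) (*-cancelˡ-≡ _ _ m (trans (sym (+-identityʳ _))
      (trans (sym (contacts-forest J)) (trans (cong contacts e) (trans (Mirrored.contacts≡ M) (roots-forest I))))))
    r′ : mrises m Q′ ≡ mcontacts m P
    r′ = trans (*-cancelˡ-≡ _ _ m (trans (sym (roots-forest J)) (trans (cong roots e)
      (trans (Mirrored.roots≡ M) (trans (contacts-forest I) (+-identityʳ _))))))
      (sym (contactsFrom≡cnt (lower-walk I)))
    cv : contactVector m P′ ↭ riseVector m Q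
    cv = ↭-trans (↭-reflexive (cong (_∷ _) c′)) (prep _ (dropLast-↭ m (cVector-end P′) (risesAfter-end (upper-walk I))
      (*-map-↭ m′ (↭-trans (↭-sym (labels-forest J)) (↭-trans (↭-reflexive (cong labels e))
        (↭-trans (Mirrored.labels↭ M) (arities-forest I)))))))
    rv : riseVector m Q′ ↭ contactVector m P
    rv = ↭-trans (↭-reflexive (cong (_∷ _) r′)) (prep _ (dropLast-↭ m (risesAfter-end (upper-walk J)) (cVector-end P)
      (*-map-↭ m′ (↭-trans (↭-sym (arities-forest J)) (↭-trans (↭-reflexive (cong arities e))
        (↭-trans (Mirrored.arities↭ M) (labels-forest I)))))))
    cQ′ : countN m Q′ ≡ n
    cQ′ = trans (sym (same-size J)) (trans (mirrors-size R) (trans (same-size I) c))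
    d : dist m n P′ Q′ ≡ dist m n P Q
    d = trans (dist≡depth n J cQ′) (trans depths (sym (dist≡depth n I c)))
      where
      depths : depth J ≡ depth I
      -- The terms in `tri m` agree because the mirror preserves the size, so equal slacks give
      -- equal depths.
      depths = *-cancelˡ-≡ _ _ m (+-cancelʳ-≡ (countN m P * tri m) _ _ (+-cancelʳ-≡ 0 _ _
        (trans (cong (λ k → m * depth J + k * tri m + 0) (sym (mirrors-size R)))
        (trans (sym (slack-forest J)) (trans (cong slack e) (trans (Mirrored.slack≡ M) (slack-forest I)))))))

  symmetry : ∀ n → PhiCoeff m n ↭ map swapXY (PhiCoeff m n)
  symmetry n = ↭-trans
    (map-↭-matching (intervalMonomial m n) (swapXY ∘ intervalMonomial m n) Mirrors mirrors-injective
      (unique-intervals n) match)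
    (↭-reflexive (map-∘ (intervals m n)))
    where
    match : ∀ {X} → X ∈ intervals m n → ∃ λ Y →
      Y ∈ intervals m n × Mirrors X Y × intervalMonomial m n Y ≡ swapXY (intervalMonomial m n X)
    match X∈ with intervals⁻ n X∈
    ... | I , c with mirror-interval I
    ... | Y , R@(I′ , J , e) =
      Y , intervals⁺ n J (trans (sym (same-size J)) (trans (mirrors-size R) (trans (same-size I) c))) , R , mirrors-monomial n c R

theorem5p5 : (m : ℕ) → 1 ≤ m → (n : ℕ) →
    PhiCoeff m n ↭ map swapXY (PhiCoeff m n)
theorem5p5 (suc m′) _ n = Tamari.symmetry m′ n
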